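{- Let $\Psi$ be the scorpion property, i.e. the class of all scorpion graphs. Then $\Psi$ is not meager, and the following problem can be solved in time $O(n^4)$: given an $n$-vertex (finite, simple, undirected) graph $G$ and $k \in \mathbb{N}$, compute the number of $k$-element subsets $X\subseteq V(G)$ such that $G[X]$ is a scorpion.
   Context: Graphs are finite, simple and undirected. A graph $H$ is a scorpion if it can be obtained from an arbitrary graph $H'$ with $|V(H')|\ge 2$ by adding three fresh vertices $b,t,s$, making $b$ adjacent to all vertices of $H'$, and adding the edges $bt$ and $ts$ (and no other edges). A graph property $\Phi$ is an isomorphism-invariant map from graphs to $\{0,1\}$ (identified with the class of graphs mapped to $1$). Its restriction $\Phi^{(k)}$ to $k$-vertex graphs is trivial if it holds for all $k$-vertex graphs or for none. $\Phi$ is meager if $\Phi^{(k)}$ is trivial for all but finitely many $k\in\mathbb{N}$. The constant hidden in the $O$-notation is independent of $k$. -}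

module Defs where

open import Data.Bool using (Bool; true; false; if_then_else_)
open import Data.Fin using (Fin; zero; suc; fromℕ<; remQuot)
open import Data.Fin.Subset using (Subset; inside; outside; ∣_∣)
open import Data.List using (List; []; _∷_; length)
open import Data.List.Membership.Propositional using (_∈_; _∉_)
open import Data.List.Relation.Unary.Unique.Propositional using (Unique)
open import Data.Maybe using (Maybe; just; nothing; maybe′)
open import Data.Nat using (ℕ; zero; suc; _+_; _*_; _∸_; _≤_; _<?_; _≡ᵇ_)
open import Data.Product using (Σ; ∃; _×_; _,_)
open import Data.Sum using (_⊎_)
open import Data.Vec using (Vec; []; _∷_; map; lookup)
open import Function.Bundles using (_↔_; _⇔_; Inverse)
open import Function.Properties.Inverse using (↔-sym; ↔-trans)
open import Relation.Binary.PropositionalEquality using (_≡_; refl; sym; trans; cong₂)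
open import Relation.Nullary using (¬_; yes; no)

record Graph (n : ℕ) : Set where
  field
    adj        : Fin n → Fin n → Bool
    adj-sym    : ∀ u v → adj u v ≡ adj v u
    adj-irrefl : ∀ v → adj v v ≡ false

open Graph public

infix 4 _≅_

_≅_ : ∀ {m n} → Graph m → Graph n → Set
_≅_ {m} {n} G H =
  Σ (Fin m ↔ Fin n) λ f →
    ∀ u v → adj G u v ≡ adj H (Inverse.to f u) (Inverse.to f v)

≅-sym : ∀ {m n} {G : Graph m} {H : Graph n} → G ≅ H → H ≅ G
≅-sym {H = H} (f , e) =
  ↔-sym f , λ u v →
    sym (trans (e (Inverse.from f u) (Inverse.from f v))
               (cong₂ (adj H) (Inverse.strictlyInverseˡ f u) (Inverse.strictlyInverseˡ f v)))

≅-trans : ∀ {l m n} {G : Graph l} {H : Graph m} {K : Graph n} → G ≅ H → H ≅ K → G ≅ K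
≅-trans (f , e) (g , e′) =
  ↔-trans f g , λ u v → trans (e u v) (e′ (Inverse.to f u) (Inverse.to f v))

-- The elements of X in increasing order.
members : ∀ {n} (X : Subset n) → Vec (Fin n) ∣ X ∣
members []            = []
members (inside  ∷ X) = zero ∷ map suc (members X)
members (outside ∷ X) = map suc (members X)

-- The induced subgraph G[X]; its i-th vertex stands for the i-th element of X.
induced : ∀ {n} → Graph n → (X : Subset n) → Graph ∣ X ∣
induced G X = record
  { adj        = λ i j → adj G (lookup (members X) i) (lookup (members X) j)
  ; adj-sym    = λ i j → adj-sym G (lookup (members X) i) (lookup (members X) j)
  ; adj-irrefl = λ i → adj-irrefl G (lookup (members X) i)
  }

record GraphProperty : Set₁ where
  field
    holds     : ∀ {n} → Graph n → Set
    invariant : ∀ {m n} {G : Graph m} {H : Graph n} → G ≅ H → holds G → holds H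

open GraphProperty public

Trivial : GraphProperty → ℕ → Set
Trivial Φ k = (∀ (G : Graph k) → holds Φ G) ⊎ (∀ (G : Graph k) → ¬ holds Φ G)

Meager : GraphProperty → Set
Meager Φ = ∃ λ (exceptions : List ℕ) → ∀ k → k ∉ exceptions → Trivial Φ k

pattern vb   = zero
pattern vt   = suc zero
pattern vs   = suc (suc zero)
pattern vH v = suc (suc (suc v))

addBTS : ∀ {m} → Graph m → Graph (3 + m)
addBTS {m} H′ = record { adj = a ; adj-sym = a-sym ; adj-irrefl = a-irrefl }
  where
  a : Fin (3 + m) → Fin (3 + m) → Bool
  a vb     vb     = false
  a vb     vt     = true
  a vb     vs     = false
  a vb     (vH _) = true
  a vt     vb     = true
  a vt     vt     = false
  a vt     vs     = true
  a vt     (vH _) = false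
  a vs     vb     = false
  a vs     vt     = true
  a vs     vs     = false
  a vs     (vH _) = false
  a (vH _) vb     = true
  a (vH _) vt     = false
  a (vH _) vs     = false
  a (vH u) (vH v) = adj H′ u v

  a-sym : ∀ u v → a u v ≡ a v u
  a-sym vb     vb     = refl
  a-sym vb     vt     = refl
  a-sym vb     vs     = refl
  a-sym vb     (vH _) = refl
  a-sym vt     vb     = refl
  a-sym vt     vt     = refl
  a-sym vt     vs     = refl
  a-sym vt     (vH _) = refl
  a-sym vs     vb     = refl
  a-sym vs     vt     = refl
  a-sym vs     vs     = refl
  a-sym vs     (vH _) = refl
  a-sym (vH _) vb     = refl
  a-sym (vH _) vt     = refl
  a-sym (vH _) vs     = refl
  a-sym (vH u) (vH v) = adj-sym H′ u v

  a-irrefl : ∀ v → a v v ≡ false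
  a-irrefl vb     = refl
  a-irrefl vt     = refl
  a-irrefl vs     = refl
  a-irrefl (vH v) = adj-irrefl H′ v

IsScorpion : ∀ {n} → Graph n → Set
IsScorpion H = ∃ λ m → Σ (Graph m) λ H′ → 2 ≤ m × H ≅ addBTS H′

scorpion : GraphProperty
scorpion = record
  { holds     = IsScorpion
  ; invariant = λ {_} {_} {G} {H} G≅H (m , H′ , 2≤m , G≅S) →
      m , H′ , 2≤m ,
      ≅-trans {G = H} {H = G} {K = addBTS H′} (≅-sym {G = G} {H = H} G≅H) G≅S
  }

HasCardinality : {A : Set} → (A → Set) → ℕ → Set
HasCardinality {A} P N =
  Σ (List A) λ xs → Unique xs × (∀ x → x ∈ xs ⇔ P x) × length xs ≡ N

InducedCount : GraphProperty → ∀ {n} → Graph n → ℕ → ℕ → Set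
InducedCount Φ {n} G k =
  HasCardinality λ (X : Subset n) → ∣ X ∣ ≡ k × holds Φ (induced G X)

-- Random-access machines with uniform cost.  Registers are addressed only
-- directly, so a program uses finitely many of them; memory cells are
-- addressed only through registers.  Arithmetic is limited to addition and
-- truncated subtraction: unit-cost multiplication would make the model
-- unreasonably powerful.

data Instr : Set where
  const : (r c : ℕ) → Instr      -- r ← c
  add   : (r x y : ℕ) → Instr    -- r ← x + y
  sub   : (r x y : ℕ) → Instr    -- r ← x ∸ y
  load  : (r x : ℕ) → Instr      -- r ← mem[x]
  store : (x y : ℕ) → Instr      -- mem[x] ← y
  jpos  : (x l : ℕ) → Instr      -- if x > 0 then goto l

Program : Set
Program = List Instr

record Config : Set where
  constructor config
  field
    pc  : ℕ
    reg : ℕ → ℕ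
    mem : ℕ → ℕ

open Config public

_[_≔_] : (ℕ → ℕ) → ℕ → ℕ → ℕ → ℕ
(f [ i ≔ v ]) j = if j ≡ᵇ i then v else f j

exec : Instr → Config → Config
exec (const r c) (config p R M) = config (suc p) (R [ r ≔ c ]) M
exec (add r x y) (config p R M) = config (suc p) (R [ r ≔ R x + R y ]) M
exec (sub r x y) (config p R M) = config (suc p) (R [ r ≔ R x ∸ R y ]) M
exec (load r x)  (config p R M) = config (suc p) (R [ r ≔ M (R x) ]) M
exec (store x y) (config p R M) = config (suc p) R (M [ R x ≔ R y ])
exec (jpos x l)  (config p R M) = config (if R x ≡ᵇ 0 then suc p else l) R M

fetch : Program → ℕ → Maybe Instr
fetch []       _       = nothing
fetch (i ∷ _)  zero    = just i
fetch (_ ∷ is) (suc p) = fetch is p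

step : Program → Config → Config
step P c = maybe′ (λ i → exec i c) c (fetch P (pc c))

run : Program → ℕ → Config → Config
run P zero    c = c
run P (suc t) c = run P t (step P c)

-- A program halts when control leaves it.
Halted : Program → Config → Set
Halted P c = length P ≤ pc c

-- The result is the content of register 0.
HaltsWithin : Program → Config → ℕ → ℕ → Set
HaltsWithin P c T out =
  ∃ λ t → t ≤ T × Halted P (run P t c) × reg (run P t c) 0 ≡ out

-- Row-major adjacency matrix: cell i * n + j holds adj i j, and cells from
-- n * n on hold 0.
matrixMem : ∀ {n} → Graph n → ℕ → ℕ
matrixMem {n} G x with x <? n * n
... | no _  = 0
... | yes p = let (i , j) = remQuot n (fromℕ< p) in if adj G i j then 1 else 0

inputConfig : ∀ {n} → Graph n → ℕ → Config
inputConfig {n} G k = config 0 (((λ _ → 0) [ 0 ≔ n ]) [ 1 ≔ k ]) (matrixMem G)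

infix 4 _∈O_

_∈O_ : (ℕ → ℕ) → (ℕ → ℕ) → Set
T ∈O f = ∃ λ c → ∃ λ n₀ → ∀ n → n₀ ≤ n → T n ≤ c * f n

-- A single program handles all inputs, and its time bound T depends on the
-- number of vertices n only, not on k.
CountingSolvableInTimeO : GraphProperty → (ℕ → ℕ) → Set
CountingSolvableInTimeO Φ f =
  Σ Program λ P → Σ (ℕ → ℕ) λ T → T ∈O f ×
    (∀ n (G : Graph n) k →
      ∃ λ N → InducedCount Φ G k N × HaltsWithin P (inputConfig G k) (T n) N)

{-# OPTIONS --safe #-}
module Submission where

-- A vertex set X induces a scorpion exactly if |X| ≥ 5 and X consists of an induced path
-- b, t, s together with vertices adjacent to b but to neither t nor s.  The triple is
-- determined by X: inside X only b has at most one non-neighbour (namely s) besides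
-- itself, and t is the only neighbour of s.  So the number of such k-sets is the sum, over
-- the n³ triples, of C(c, k - 3), where c counts the candidates for the remaining vertices
-- and is found in time O(n).  The column k - 3 of Pascal's triangle is tabulated beforehand
-- in time O(n²), by additions only.

open import Defs
open import Algebra.Properties.CommutativeSemigroup using (interchange)
open import Data.Bool using (true; false; if_then_else_; T; not)
import Data.Bool.Properties as Bool
open import Data.Empty using (⊥; ⊥-elim)
open import Data.Fin using (Fin; zero; suc; toℕ; combine; remQuot)
open import Data.Fin.Permutation using (↔⇒≡)
import Data.Fin.Properties as Fin
open import Data.Fin.Subset using (Subset; Side; inside; outside; ∣_∣)
open import Data.List using (List; []; _∷_; _++_; length; concat; map; tabulate)
open import Data.List.Membership.Propositional using (_∈_)
open import Data.List.Membership.Propositional.Properties using (∈-map⁺; ∈-map⁻; ∈-++⁺ˡ; ∈-++⁺ʳ; ∈-++⁻; ∈-concat⁺′; ∈-concat⁻′; ∈-tabulate⁺; ∈-tabulate⁻)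
open import Data.List.Properties using (++-assoc; length-++; length-map)
open import Data.List.Relation.Unary.All using ([])
import Data.List.Relation.Unary.All.Properties as All
open import Data.List.Relation.Unary.AllPairs using ([]; _∷_)
import Data.List.Relation.Unary.AllPairs.Properties as AllPairs
open import Data.List.Relation.Unary.Any using (here; there)
open import Data.List.Relation.Unary.Unique.Propositional using (Unique)
import Data.List.Relation.Unary.Unique.Propositional.Properties as Unique
open import Data.Maybe using (just)
open import Data.Nat using (ℕ; zero; suc; _+_; _*_; _∸_; _^_; _⊓_; _⊔_; _≤_; _<_; _<?_; _≤?_; _≡ᵇ_; z≤n; s≤s)
open import Data.Nat.Combinatorics using (_C_; k>n⇒nCk≡0; nCk+nC[k+1]≡[n+1]C[k+1])
open import Data.Nat.ListAction using (sum)
open import Data.Nat.Properties as ℕ hiding (_≟_)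
open import Data.Nat.Tactic.RingSolver using (solve-∀)
open import Data.Product using (Σ; ∃; _×_; _,_; proj₁; proj₂)
open import Data.Sum using (_⊎_; inj₁; inj₂)
open import Data.Unit using (⊤; tt)
open import Data.Vec as Vec using ([]; _∷_; lookup)
open import Data.Vec.Properties using (lookup-map; lookup∘tabulate; ∷-injectiveʳ)
open import Function using (_∘_)
open import Function.Bundles using (_↔_; _⇔_; mk⇔; mk↔ₛ′; Inverse)
open import Function.Definitions using (Injective)
open import Function.Properties.Inverse using (↔-refl)
open import Relation.Binary.PropositionalEquality using (_≡_; _≢_; refl; sym; trans; cong; cong₂; subst; subst₂; module ≡-Reasoning)
open import Relation.Nullary using (¬_; Dec; yes; no; does; contradiction; _×-dec_; ¬?)
open import Relation.Nullary.Decidable using (dec-true)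

-- A structured language compiled to the machine

-- Two obstacles shape the program. The time may not depend on k, so every loop makes exactly n
-- rounds and the table stops at column min(n, k - 3). This is harmless: b is never a candidate, so
-- c < n, and if k - 3 > n then C(c, n) and C(c, k - 3) both vanish. The machine cannot multiply, so
-- even n² and the offsets of the matrix rows are produced by repeated addition. The condition |X| ≥
-- 5 is needed for more than the definition: it supplies two vertices of H′, without which b cannot
-- be recognised. On a path with four vertices either end could serve as s, so the triple would not
-- be unique. For k < 5 the sum over triples would still count something (for k = 3, the induced
-- paths), hence a separate flag forces the answer 0.

record State : Set where
  constructor ⟨_,_⟩
  field
    regs  : ℕ → ℕ
    cells : ℕ → ℕ

open State

-- Register size holds the number of vertices, which every loop runs through; τ is a
-- scratch register of the compiled loops and conditionals.
size τ : ℕ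
size = 0
τ    = 2

infixr 5 _⨾_

-- Without unbounded loops `eval` is a total function by structural recursion, and the degree of the
-- running time can be read off the syntax.
data Stmt : Set where
  op    : Instr → Stmt
  _⨾_   : Stmt → Stmt → Stmt
  ifPos : ℕ → Stmt → Stmt
  for   : ℕ → Stmt → Stmt

effect : Instr → State → State
effect i ⟨ R , M ⟩ = ⟨ reg c , mem c ⟩
  where
  c : Config
  c = exec i (config 0 R M)

-- `jpos` jumps on positive values, whereas `ifPos` has to jump over its body when the tested value
-- is zero. Its truncated difference from 1 is positive exactly then.
complement : ℕ → State → State
complement x σ = effect (sub τ τ x) (effect (const τ 1) σ)

-- The difference is the number of rounds left, and so serves directly as the condition of the
-- closing jump.
test : ℕ → State → State
test i = effect (sub τ size i)

next : ℕ → State → State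
next i σ = test i (effect (add i i τ) (effect (const τ 1) σ))

init : ℕ → State → State
init i σ = test i (effect (const τ 1) (effect (const i 0) σ))

eval : Stmt → State → State
iter : ℕ → Stmt → ℕ → State → State

eval (op i)      σ = effect i σ
eval (s ⨾ s′)    σ = eval s′ (eval s σ)
eval (ifPos x s) σ =
  if regs (complement x σ) τ ≡ᵇ 0 then eval s (complement x σ) else complement x σ
eval (for i s)   σ = iter i s (regs σ size) (init i σ)

iter i s zero    σ = σ
iter i s (suc k) σ = iter i s k (next i (eval s σ))

cost : Stmt → State → ℕ
costIter : ℕ → Stmt → ℕ → State → ℕ

cost (op i)      σ = 1
cost (s ⨾ s′)    σ = cost s σ + cost s′ (eval s σ)
cost (ifPos x s) σ = 3 + (if regs (complement x σ) τ ≡ᵇ 0 then cost s (complement x σ) else 0)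
-- Two constants, the entering jump and the test make 4. The `suc` is there because the closing jump
-- is executed once more than there are rounds.
cost (for i s)   σ = 4 + suc (costIter i s (regs σ size) (init i σ))

costIter i s zero    σ = 0
costIter i s (suc k) σ = cost s σ + (4 + costIter i s k (next i (eval s σ)))

end : ℕ → Stmt → ℕ
end o (op i)      = suc o
end o (s ⨾ s′)    = end (end o s) s′
end o (ifPos x s) = end (3 + o) s
end o (for i s)   = 4 + end (3 + o) s

loopTail : ℕ → ℕ → Program
loopTail o i = const τ 1 ∷ add i i τ ∷ sub τ size i ∷ jpos τ (3 + o) ∷ []

compile : ℕ → Stmt → Program
compile o (op i)      = i ∷ []
compile o (s ⨾ s′)    = compile o s ++ compile (end o s) s′
compile o (ifPos x s) =
  const τ 1 ∷ sub τ τ x ∷ jpos τ (end (3 + o) s) ∷ compile (3 + o) s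
compile o (for i s)   =
  -- With `τ` set to 1 the jump is unconditional. It enters `loopTail` at its test, past the
  -- increment, so that the body is skipped when `size` is 0.
  const i 0 ∷ const τ 1 ∷ jpos τ (2 + end (3 + o) s) ∷
  compile (3 + o) s ++ loopTail o i

-- Encoded through `T`, so that on concrete registers this condition, and with it `Fresh` and
-- `WellFormed` of a whole program, computes to a product of `⊤`s and is filled by `_`.
Distinct : ℕ → ℕ → Set
Distinct r r′ = T (not (r ≡ᵇ r′))

Unwritten : ℕ → Instr → Set
Unwritten r (const r′ c) = Distinct r r′
Unwritten r (add r′ x y) = Distinct r r′
Unwritten r (sub r′ x y) = Distinct r r′
Unwritten r (load r′ x)  = Distinct r r′
Unwritten r (store x y)  = ⊤
Unwritten r (jpos x l)   = ⊤

Fresh : ℕ → Stmt → Set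
Fresh r (op i)      = Unwritten r i
Fresh r (s ⨾ s′)    = Fresh r s × Fresh r s′
Fresh r (ifPos x s) = Distinct r τ × Fresh r s
Fresh r (for i s)   = Distinct r τ × Distinct r i × Fresh r s

Straight : Instr → Set
Straight (jpos x l) = ⊥
Straight _          = ⊤

-- Since loop bodies change neither the loop index nor size, a loop makes exactly size
-- rounds, as eval assumes.
WellFormed : Stmt → Set
WellFormed (op i)      = Straight i
WellFormed (s ⨾ s′)    = WellFormed s × WellFormed s′ × Fresh size s
WellFormed (ifPos x s) = WellFormed s
WellFormed (for i s)   =
  WellFormed s × Fresh size s × Fresh i s × Distinct size i × Distinct i τ

≔-other : ∀ (R : ℕ → ℕ) {r r′} v → Distinct r r′ → (R [ r′ ≔ v ]) r ≡ R r
≔-other R {r} {r′} v d with r ≡ᵇ r′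
... | false = refl

≡ᵇ-refl : ∀ r → (r ≡ᵇ r) ≡ true
≡ᵇ-refl zero    = refl
≡ᵇ-refl (suc r) = ≡ᵇ-refl r

≔-same : ∀ (R : ℕ → ℕ) r v → (R [ r ≔ v ]) r ≡ v
≔-same R r v rewrite ≡ᵇ-refl r = refl

effect-fresh : ∀ r i σ → Unwritten r i → regs (effect i σ) r ≡ regs σ r
effect-fresh r (const r′ c) ⟨ R , M ⟩ d = ≔-other R _ d
effect-fresh r (add r′ x y) ⟨ R , M ⟩ d = ≔-other R _ d
effect-fresh r (sub r′ x y) ⟨ R , M ⟩ d = ≔-other R _ d
effect-fresh r (load r′ x)  ⟨ R , M ⟩ d = ≔-other R _ d
effect-fresh r (store x y)  ⟨ R , M ⟩ d = refl
effect-fresh r (jpos x l)   ⟨ R , M ⟩ d = refl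

next-fresh : ∀ r i σ → Distinct r τ → Distinct r i → regs (next i σ) r ≡ regs σ r
next-fresh r i σ dτ di =
  trans (effect-fresh r (sub τ size i) (effect (add i i τ) (effect (const τ 1) σ)) dτ)
  (trans (effect-fresh r (add i i τ) (effect (const τ 1) σ) di)
         (effect-fresh r (const τ 1) σ dτ))

init-fresh : ∀ r i σ → Distinct r τ → Distinct r i → regs (init i σ) r ≡ regs σ r
init-fresh r i σ dτ di =
  trans (effect-fresh r (sub τ size i) (effect (const τ 1) (effect (const i 0) σ)) dτ)
  (trans (effect-fresh r (const τ 1) (effect (const i 0) σ) dτ)
         (effect-fresh r (const i 0) σ di))

complement-fresh : ∀ r x σ → Distinct r τ → regs (complement x σ) r ≡ regs σ r
complement-fresh r x σ dτ =
  trans (effect-fresh r (sub τ τ x) (effect (const τ 1) σ) dτ) (effect-fresh r (const τ 1) σ dτ)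

eval-fresh : ∀ r s σ → Fresh r s → regs (eval s σ) r ≡ regs σ r
iter-fresh : ∀ r i s k σ → Fresh r (for i s) → regs (iter i s k σ) r ≡ regs σ r

eval-fresh r (op i)      σ d        = effect-fresh r i σ d
eval-fresh r (s ⨾ s′)    σ (d , d′) = trans (eval-fresh r s′ (eval s σ) d′) (eval-fresh r s σ d)
eval-fresh r (ifPos x s) σ (dτ , d) with regs (complement x σ) τ ≡ᵇ 0
... | true  = trans (eval-fresh r s (complement x σ) d) (complement-fresh r x σ dτ)
... | false = complement-fresh r x σ dτ
eval-fresh r (for i s)   σ d@(dτ , di , _) =
  trans (iter-fresh r i s (regs σ size) (init i σ) d) (init-fresh r i σ dτ di)

iter-fresh r i s zero    σ d = refl
iter-fresh r i s (suc k) σ d@(dτ , di , ds) =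
  trans (iter-fresh r i s k (next i (eval s σ)) d)
  (trans (next-fresh r i (eval s σ) dτ di) (eval-fresh r s σ ds))

init-index : ∀ i σ → Distinct i τ → regs (init i σ) i ≡ 0
init-index i σ@(⟨ R , M ⟩) d =
  trans (effect-fresh i (sub τ size i) (effect (const τ 1) (effect (const i 0) σ)) d)
  (trans (effect-fresh i (const τ 1) (effect (const i 0) σ) d) (≔-same R i 0))

next-index : ∀ i σ → Distinct i τ → regs (next i σ) i ≡ suc (regs σ i)
next-index i σ@(⟨ R , M ⟩) d =
  trans (effect-fresh i (sub τ size i) (effect (add i i τ) (effect (const τ 1) σ)) d)
  (trans (≔-same (R [ τ ≔ 1 ]) i _)
  (trans (+-comm _ 1) (cong suc (≔-other R 1 d))))

eval-ifPos-zero : ∀ x s σ → Distinct x τ → regs σ x ≡ 0 → eval (ifPos x s) σ ≡ complement x σ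
eval-ifPos-zero x s σ d e =
  cong (λ w → if 1 ∸ w ≡ᵇ 0 then eval s (complement x σ) else complement x σ)
    (trans (≔-other (regs σ) 1 d) e)

eval-ifPos-suc : ∀ x s σ {m} → Distinct x τ → regs σ x ≡ suc m →
  eval (ifPos x s) σ ≡ eval s (complement x σ)
eval-ifPos-suc x s σ {m} d e = trans
  (cong (λ w → if 1 ∸ w ≡ᵇ 0 then eval s (complement x σ) else complement x σ)
    (trans (≔-other (regs σ) 1 d) e))
  (cong (λ w → if w ≡ᵇ 0 then eval s (complement x σ) else complement x σ) (0∸n≡0 m))

StoreFree : Stmt → Set
StoreFree (op (store x y)) = ⊥
StoreFree (op _)           = ⊤
StoreFree (s ⨾ s′)         = StoreFree s × StoreFree s′
StoreFree (ifPos x s)      = StoreFree s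
StoreFree (for i s)        = StoreFree s

eval-storeFree : ∀ s σ → StoreFree s → cells (eval s σ) ≡ cells σ
iter-storeFree : ∀ i s k σ → StoreFree s → cells (iter i s k σ) ≡ cells σ

eval-storeFree (op (const r c)) σ f = refl
eval-storeFree (op (add r x y)) σ f = refl
eval-storeFree (op (sub r x y)) σ f = refl
eval-storeFree (op (load r x))  σ f = refl
eval-storeFree (op (jpos x l))  σ f = refl
eval-storeFree (s ⨾ s′)    σ (f , f′) =
  trans (eval-storeFree s′ (eval s σ) f′) (eval-storeFree s σ f)
eval-storeFree (ifPos x s) σ f with regs (complement x σ) τ ≡ᵇ 0
... | true  = eval-storeFree s (complement x σ) f
... | false = refl
eval-storeFree (for i s)   σ f = iter-storeFree i s (regs σ size) (init i σ) f

iter-storeFree i s zero    σ f = refl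
iter-storeFree i s (suc k) σ f =
  trans (iter-storeFree i s k (next i (eval s σ)) f) (eval-storeFree s σ f)

-- Invariants of loops

Frame : Stmt → State → State → Set
Frame s σ ρ = (∀ r → Fresh r s → regs ρ r ≡ regs σ r) × (StoreFree s → cells ρ ≡ cells σ)

-- A Hoare rule. The frame hands each round whatever the loop cannot write, so an invariant need
-- only mention what changes. It is stated after `init` and `next`, because these still write the
-- index and `τ`.
for-invariant : ∀ {n} i s σ (I : ℕ → State → Set) → WellFormed (for i s) → regs σ size ≡ n →
  I 0 (init i σ) →
  (∀ j ρ → j < n → Frame (for i s) σ ρ → regs ρ i ≡ j → I j ρ → I (suc j) (next i (eval s ρ))) →
  I n (eval (for i s) σ)
for-invariant {n} i s σ I (_ , _ , fi , _ , i≢τ) refl base step =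
  go n 0 (init i σ) (+-identityʳ n)
    ((λ r (r≢τ , r≢i , _) → init-fresh r i σ r≢τ r≢i) , λ _ → refl) (init-index i σ i≢τ) base
  where
  go : ∀ k j ρ → k + j ≡ n → Frame (for i s) σ ρ → regs ρ i ≡ j → I j ρ → I n (iter i s k ρ)
  go zero    j ρ refl _               i≡ inv = inv
  go (suc k) j ρ eq   frame@(fr , fc) i≡ inv =
    go k (suc j) (next i (eval s ρ)) (trans (+-suc k j) eq)
      ((λ r d@(r≢τ , r≢i , ds) →
          trans (next-fresh r i (eval s ρ) r≢τ r≢i) (trans (eval-fresh r s ρ ds) (fr r d))) ,
        λ f → trans (eval-storeFree s ρ f) (fc f))
      (trans (next-index i (eval s ρ) i≢τ) (cong suc (trans (eval-fresh i s ρ fi) i≡)))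
      (step j ρ (≤-trans (s≤s (m≤n+m j k)) (≤-reflexive eq)) frame i≡ inv)

-- Correctness of the compiler

CodeAt : Program → ℕ → Program → Set
CodeAt P o []      = ⊤
CodeAt P o (i ∷ c) = fetch P o ≡ just i × CodeAt P (suc o) c

codeAt-++ : ∀ P o c {d} → CodeAt P o (c ++ d) → CodeAt P o c × CodeAt P (length c + o) d
codeAt-++ P o []      h       = tt , h
codeAt-++ P o (i ∷ c) {d} (e , h) with codeAt-++ P (suc o) c h
... | h₁ , h₂ = (e , h₁) , subst (λ p → CodeAt P p d) (+-suc (length c) o) h₂

codeAt-suffix : ∀ c pre → CodeAt (pre ++ c) (length pre) c
codeAt-suffix []      pre = tt
codeAt-suffix (i ∷ c) pre = fetch-here pre ,
  subst₂ (λ P p → CodeAt P p c) (++-assoc pre (i ∷ []) c)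
    (trans (length-++ pre) (+-comm _ 1)) (codeAt-suffix c (pre ++ i ∷ []))
  where
  fetch-here : ∀ pre → fetch (pre ++ i ∷ c) (length pre) ≡ just i
  fetch-here []        = refl
  fetch-here (_ ∷ pre) = fetch-here pre

length-compile : ∀ o s → length (compile o s) + o ≡ end o s
length-compile o (op i)      = refl
length-compile o (s ⨾ s′)    = begin
  length (compile o s ++ compile (end o s) s′) + o
    ≡⟨ cong (_+ o) (length-++ (compile o s)) ⟩
  (length (compile o s) + length (compile (end o s) s′)) + o
    ≡⟨ cong (_+ o) (+-comm (length (compile o s)) _) ⟩
  (length (compile (end o s) s′) + length (compile o s)) + o
    ≡⟨ +-assoc (length (compile (end o s) s′)) _ o ⟩
  length (compile (end o s) s′) + (length (compile o s) + o)
    ≡⟨ cong (length (compile (end o s) s′) +_) (length-compile o s) ⟩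
  length (compile (end o s) s′) + end o s
    ≡⟨ length-compile (end o s) s′ ⟩
  end (end o s) s′ ∎
  where
  open ≡-Reasoning
length-compile o (ifPos x s) =
  trans (sym (trans (+-suc l (2 + o)) (cong suc (trans (+-suc l (suc o)) (cong suc (+-suc l o))))))
        (length-compile (3 + o) s)
  where l = length (compile (3 + o) s)
length-compile o (for i s)   = begin
  3 + (length (compile (3 + o) s ++ loopTail o i) + o)
    ≡⟨ cong (λ m → 3 + (m + o)) (trans (length-++ (compile (3 + o) s)) (+-comm l 4)) ⟩
  4 + (3 + (l + o))
    ≡⟨ cong (4 +_) (sym
         (trans (+-suc l (2 + o)) (cong suc (trans (+-suc l (suc o)) (cong suc (+-suc l o)))))) ⟩
  4 + (l + (3 + o))
    ≡⟨ cong (4 +_) (length-compile (3 + o) s) ⟩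
  4 + end (3 + o) s ∎
  where
  open ≡-Reasoning
  l = length (compile (3 + o) s)

codeAt-loop : ∀ P o i s → CodeAt P o (compile o (for i s)) →
  CodeAt P (3 + o) (compile (3 + o) s) × CodeAt P (end (3 + o) s) (loopTail o i)
codeAt-loop P o i s (_ , _ , _ , h) with codeAt-++ P (3 + o) (compile (3 + o) s) h
... | h₁ , h₂ = h₁ , subst (λ p → CodeAt P p (loopTail o i)) (length-compile (3 + o) s) h₂

at : ℕ → State → Config
at p σ = config p (regs σ) (cells σ)

run-+ : ∀ P a b c → run P (a + b) c ≡ run P b (run P a c)
run-+ P zero    b c = refl
run-+ P (suc a) b c = run-+ P a b (step P c)

step-fetch : ∀ P c {i} → fetch P (pc c) ≡ just i → step P c ≡ exec i c
step-fetch P c e rewrite e = refl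

run-suc : ∀ P t c {i} → fetch P (pc c) ≡ just i → run P (suc t) c ≡ run P t (exec i c)
run-suc P t c e = cong (run P t) (step-fetch P c e)

exec-straight : ∀ i o σ → Straight i → exec i (at o σ) ≡ at (suc o) (effect i σ)
exec-straight (const r c) o σ s = refl
exec-straight (add r x y) o σ s = refl
exec-straight (sub r x y) o σ s = refl
exec-straight (load r x)  o σ s = refl
exec-straight (store x y) o σ s = refl

test-index : ∀ i σ k → k + regs σ i ≡ regs σ size →
  regs (test i σ) τ ≡ k
test-index i σ k e = trans (cong (_∸ regs σ i) (sym e)) (m+n∸n≡m k (regs σ i))

simulate : ∀ P s o σ → WellFormed s → CodeAt P o (compile o s) →
  run P (cost s σ) (at o σ) ≡ at (end o s) (eval s σ)

-- The induction starts at the closing jump, where entering the loop and finishing a round meet.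
-- There `τ` holds the number of rounds left, so that zero means falling through.
simulate-iter : ∀ P i s o k σ → WellFormed (for i s) → CodeAt P o (compile o (for i s)) →
  k + regs σ i ≡ regs σ size → regs σ τ ≡ k →
  run P (suc (costIter i s k σ)) (at (3 + end (3 + o) s) σ) ≡ at (4 + end (3 + o) s) (iter i s k σ)

simulate P (op i) o σ w (e , _) = trans (run-suc P 0 (at o σ) e) (exec-straight i o σ w)
simulate P (s ⨾ s′) o σ (w , w′ , _) h with codeAt-++ P o (compile o s) h
... | h₁ , h₂ = begin
  run P (cost s σ + cost s′ (eval s σ)) (at o σ)
    ≡⟨ run-+ P (cost s σ) _ (at o σ) ⟩
  run P (cost s′ (eval s σ)) (run P (cost s σ) (at o σ))
    ≡⟨ cong (run P (cost s′ (eval s σ))) (simulate P s o σ w h₁) ⟩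
  run P (cost s′ (eval s σ)) (at (end o s) (eval s σ))
    ≡⟨ simulate P s′ (end o s) (eval s σ) w′
         (subst (λ p → CodeAt P p (compile (end o s) s′)) (length-compile o s) h₂) ⟩
  at (end (end o s) s′) (eval s′ (eval s σ)) ∎
  where open ≡-Reasoning
simulate P (ifPos x s) o σ w (e₀ , e₁ , e₂ , h) =
  trans (run-suc P (2 + c) (at o σ) e₀)
  (trans (run-suc P (1 + c) (at (1 + o) (effect (const τ 1) σ)) e₁)
  (trans (run-suc P c (at (2 + o) (complement x σ)) e₂) rest))
  where
  c : ℕ
  c = if regs (complement x σ) τ ≡ᵇ 0 then cost s (complement x σ) else 0
  rest : run P (if regs (complement x σ) τ ≡ᵇ 0 then cost s (complement x σ) else 0)
           (exec (jpos τ (end (3 + o) s)) (at (2 + o) (complement x σ)))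
         ≡ at (end (3 + o) s) (eval (ifPos x s) σ)
  rest with regs (complement x σ) τ ≡ᵇ 0
  ... | true  = simulate P s (3 + o) (complement x σ) w h
  ... | false = refl
simulate P (for i s) o σ w@(ws , fN , fi , N≢i , i≢τ) h@(e₀ , e₁ , e₂ , _) =
  trans (run-suc P (4 + c) (at o σ) e₀)
  (trans (run-suc P (3 + c) (at (1 + o) (effect (const i 0) σ)) e₁)
  (trans (run-suc P (2 + c) (at (2 + o) σ₀) e₂)
  (trans (run-suc P (1 + c) (at (2 + end (3 + o) s) σ₀) e₃)
  (simulate-iter P i s o (regs σ size) (init i σ) w h index-zero
    (test-index i σ₀ (regs σ size)
      (trans (cong (regs σ size +_) (sym (effect-fresh i (sub τ size i) σ₀ i≢τ)))
        (trans index-zero (effect-fresh size (sub τ size i) σ₀ tt))))))))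
  where
  σ₀ : State
  σ₀ = effect (const τ 1) (effect (const i 0) σ)
  c : ℕ
  c = costIter i s (regs σ size) (init i σ)
  index-zero : regs σ size + regs (init i σ) i ≡ regs (init i σ) size
  index-zero = trans (cong (regs σ size +_) (init-index i σ i≢τ))
    (trans (+-identityʳ _) (sym (init-fresh size i σ tt N≢i)))
  e₃ : fetch P (2 + end (3 + o) s) ≡ just (sub τ size i)
  e₃ = proj₁ (proj₂ (proj₂ (proj₂ (codeAt-loop P o i s h))))

simulate-iter P i s o zero σ w h eq eqτ with codeAt-loop P o i s h
... | _ , _ , _ , _ , e₆ , _ =
  trans (run-suc P 0 (at (3 + end (3 + o) s) σ) e₆)
    (cong (λ v → config (if v ≡ᵇ 0 then 4 + end (3 + o) s else 3 + o) (regs σ) (cells σ)) eqτ)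
simulate-iter P i s o (suc k) σ w@(ws , fN , fi , N≢i , i≢τ) h eq eqτ
  with codeAt-loop P o i s h
... | h₁ , e₃ , e₄ , e₅ , e₆ , _ = begin
  run P (suc (cost s σ + (4 + c′))) (at (3 + end (3 + o) s) σ)
    ≡⟨ run-suc P (cost s σ + (4 + c′)) (at (3 + end (3 + o) s) σ) e₆ ⟩
  run P (cost s σ + (4 + c′)) (exec (jpos τ (3 + o)) (at (3 + end (3 + o) s) σ))
    ≡⟨ cong (λ v → run P (cost s σ + (4 + c′))
         (config (if v ≡ᵇ 0 then 4 + end (3 + o) s else 3 + o) (regs σ) (cells σ))) eqτ ⟩
  run P (cost s σ + (4 + c′)) (at (3 + o) σ)
    ≡⟨ run-+ P (cost s σ) (4 + c′) (at (3 + o) σ) ⟩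
  run P (4 + c′) (run P (cost s σ) (at (3 + o) σ))
    ≡⟨ cong (run P (4 + c′)) (simulate P s (3 + o) σ ws h₁) ⟩
  run P (4 + c′) (at (end (3 + o) s) σ′)
    ≡⟨ run-suc P (3 + c′) (at (end (3 + o) s) σ′) e₃ ⟩
  run P (3 + c′) (at (1 + end (3 + o) s) (effect (const τ 1) σ′))
    ≡⟨ run-suc P (2 + c′) (at (1 + end (3 + o) s) (effect (const τ 1) σ′)) e₄ ⟩
  run P (2 + c′) (at (2 + end (3 + o) s) σ″)
    ≡⟨ run-suc P (1 + c′) (at (2 + end (3 + o) s) σ″) e₅ ⟩
  run P (1 + c′) (at (3 + end (3 + o) s) (next i σ′))
    ≡⟨ simulate-iter P i s o k (next i σ′) w h eq′
         (test-index i σ″ k (trans (cong (k +_) (sym (effect-fresh i (sub τ size i) σ″ i≢τ))) eq′)) ⟩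
  at (4 + end (3 + o) s) (iter i s k (next i σ′)) ∎
  where
  open ≡-Reasoning
  σ′ σ″ : State
  σ′ = eval s σ
  σ″ = effect (add i i τ) (effect (const τ 1) σ′)
  c′ : ℕ
  c′ = costIter i s k (next i σ′)
  eq′ : k + regs (next i σ′) i ≡ regs (next i σ′) size
  eq′ = trans (cong (k +_) (trans (next-index i σ′ i≢τ) (cong suc (eval-fresh i s σ fi))))
        (trans (+-suc k _) (trans eq
        (sym (trans (next-fresh size i σ′ tt N≢i) (eval-fresh size s σ fN)))))

-- Static cost bounds

factor depth : Stmt → ℕ
factor (op i)      = 1
factor (s ⨾ s′)    = factor s + factor s′
factor (ifPos x s) = 3 + factor s
factor (for i s)   = 5 + (4 + factor s)

depth (op i)      = 0
depth (s ⨾ s′)    = depth s ⊔ depth s′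
depth (ifPos x s) = depth s
depth (for i s)   = suc (depth s)

-- Powers of `suc n` are at least 1 even for n = 0 and grow with the exponent, so constants and
-- parts of smaller depth can all be raised to the largest power that occurs.
bound : Stmt → ℕ → ℕ
bound s n = factor s * suc n ^ depth s

c≤c*[1+n]^d : ∀ c n d → c ≤ c * suc n ^ d
c≤c*[1+n]^d c n d = ≤-trans (≤-reflexive (sym (*-identityʳ c))) (*-monoʳ-≤ c (m^n>0 (suc n) d))

cost-bounded : ∀ s σ → WellFormed s → cost s σ ≤ bound s (regs σ size)
costIter-bounded : ∀ i s k n σ → WellFormed (for i s) → regs σ size ≡ n →
  costIter i s k σ ≤ k * ((4 + factor s) * suc n ^ depth s)

cost-bounded (op i) σ w = ≤-refl
cost-bounded (s ⨾ s′) σ (w , w′ , fN) = begin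
  cost s σ + cost s′ (eval s σ)
    ≤⟨ +-mono-≤ (cost-bounded s σ w) (cost-bounded s′ (eval s σ) w′) ⟩
  bound s n + bound s′ (regs (eval s σ) size)
    ≡⟨ cong (λ m → bound s n + bound s′ m) (eval-fresh size s σ fN) ⟩
  bound s n + bound s′ n
    ≤⟨ +-mono-≤ (*-monoʳ-≤ (factor s) (^-monoʳ-≤ (suc n) (m≤m⊔n (depth s) (depth s′))))
                (*-monoʳ-≤ (factor s′) (^-monoʳ-≤ (suc n) (m≤n⊔m (depth s) (depth s′)))) ⟩
  factor s * suc n ^ depth (s ⨾ s′) + factor s′ * suc n ^ depth (s ⨾ s′)
    ≡⟨ *-distribʳ-+ (suc n ^ depth (s ⨾ s′)) (factor s) (factor s′) ⟨
  bound (s ⨾ s′) n ∎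
  where
  open ≤-Reasoning
  n = regs σ size
cost-bounded (ifPos x s) σ w = ≤-trans (+-mono-≤ (c≤c*[1+n]^d 3 n (depth s)) branch)
  (≤-reflexive (sym (*-distribʳ-+ (suc n ^ depth s) 3 (factor s))))
  where
  n = regs σ size
  branch : (if regs (complement x σ) τ ≡ᵇ 0 then cost s (complement x σ) else 0) ≤ bound s n
  branch with regs (complement x σ) τ ≡ᵇ 0
  ... | true  = ≤-trans (cost-bounded s (complement x σ) w)
                  (≤-reflexive (cong (bound s) (complement-fresh size x σ tt)))
  ... | false = z≤n
cost-bounded (for i s) σ w@(ws , fN , fi , N≢i , _) = begin
  5 + costIter i s n (init i σ)
    ≤⟨ +-mono-≤ (c≤c*[1+n]^d 5 n (suc (depth s)))
         (costIter-bounded i s n n (init i σ) w (init-fresh size i σ tt N≢i)) ⟩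
  5 * suc n ^ suc (depth s) + n * (f * suc n ^ depth s)
    ≤⟨ +-monoʳ-≤ (5 * suc n ^ suc (depth s)) (*-monoˡ-≤ (f * suc n ^ depth s) (n≤1+n n)) ⟩
  5 * suc n ^ suc (depth s) + suc n * (f * suc n ^ depth s)
    ≡⟨ cong (5 * suc n ^ suc (depth s) +_)
         (trans (sym (*-assoc (suc n) f (suc n ^ depth s)))
         (trans (cong (_* suc n ^ depth s) (*-comm (suc n) f)) (*-assoc f (suc n) (suc n ^ depth s)))) ⟩
  5 * suc n ^ suc (depth s) + f * suc n ^ suc (depth s)
    ≡⟨ *-distribʳ-+ (suc n ^ suc (depth s)) 5 f ⟨
  bound (for i s) n ∎
  where
  open ≤-Reasoning
  n f : ℕ
  n = regs σ size
  f = 4 + factor s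

costIter-bounded i s zero    n σ w N≡ = z≤n
costIter-bounded i s (suc k) n σ w@(ws , fN , fi , N≢i , _) N≡ = begin
  cost s σ + (4 + costIter i s k (next i (eval s σ)))
    ≤⟨ +-mono-≤ (≤-trans (cost-bounded s σ ws) (≤-reflexive (cong (bound s) N≡)))
         (+-mono-≤ (c≤c*[1+n]^d 4 n (depth s)) (costIter-bounded i s k n (next i (eval s σ)) w
           (trans (next-fresh size i (eval s σ) tt N≢i) (trans (eval-fresh size s σ fN) N≡)))) ⟩
  bound s n + (4 * e + k * (f * e))
    ≡⟨ +-assoc (bound s n) (4 * e) (k * (f * e)) ⟨
  (bound s n + 4 * e) + k * (f * e)
    ≡⟨ cong (_+ k * (f * e)) (trans (+-comm (bound s n) (4 * e)) (sym (*-distribʳ-+ e 4 (factor s)))) ⟩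
  f * e + k * (f * e) ∎
  where
  open ≤-Reasoning
  f e : ℕ
  f = 4 + factor s
  e = suc n ^ depth s

-- The counting program

∑ : ℕ → (ℕ → ℕ) → ℕ
∑ zero    f = 0
∑ (suc n) f = ∑ n f + f n

≔-miss : ∀ (M : ℕ → ℕ) {a b} v → b ≢ a → (M [ a ≔ v ]) b ≡ M b
≔-miss M {a} {b} v b≢a with b ≡ᵇ a in eq
... | false = refl
... | true  = contradiction (≡ᵇ⇒≡ b a (subst T (sym eq) tt)) b≢a

-- target is the size k of the subsets, base the start of the table of binomial
-- coefficients, left the number of prefix-sum rounds still to be made, and small is 1 if
-- k < 5 and 0 otherwise; rowB, rowT, rowS are the offsets of the matrix rows of b, t, s.
target one base left acc addr u v ib it is ix rowB rowT rowS cnt total small round col : ℕ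
target = 1
one    = 3
base   = 4
left   = 5
acc    = 6
addr   = 7
u      = 8
v      = 9
ib     = 10
it     = 11
is     = 12
ix     = 13
rowB   = 14
rowT   = 15
rowS   = 16
cnt    = 17
total  = 18
small  = 19
round  = 20
col    = 21

-- The address n² is the first one behind the matrix; the table of binomial coefficients starts
-- there.
squareSize : Stmt
squareSize = op (const base 0) ⨾ for round (op (add base base size))

squareSize-base : ∀ σ → regs (eval squareSize σ) base ≡ regs σ size * regs σ size
squareSize-base σ =
  for-invariant round (op (add base base size)) (effect (const base 0) σ)
    (λ j ρ → regs ρ base ≡ j * regs σ size) _ refl refl
    (λ j ρ j<n (fr , _) _ inv → trans (cong₂ _+_ inv (fr size _)) (+-comm (j * regs σ size) _))

-- Column 0 of Pascal's triangle, the start of the repeated prefix sums.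
fillOnes : Stmt
fillOnes = for col (op (add addr base col) ⨾ op (store addr one))

SameBelow : ℕ → State → State → Set
SameBelow B σ ρ = ∀ a → a < B → cells ρ a ≡ cells σ a

Table : ℕ → ℕ → ℕ → State → Set
Table n B d ρ = ∀ x → x < n → cells ρ (B + x) ≡ x C d

below-store : ∀ (M : ℕ → ℕ) {a B j v} → a ≡ B + j → ∀ x → x < B → (M [ a ≔ v ]) x ≡ M x
below-store M {B = B} {j} refl x x<B =
  ≔-miss M _ (λ e → <-irrefl e (≤-trans x<B (m≤m+n B j)))

table-store : ∀ (M : ℕ → ℕ) {a B j v d} → a ≡ B + j → v ≡ j C d →
  (∀ x → x < j → M (B + x) ≡ x C d) → ∀ x → x < suc j → (M [ a ≔ v ]) (B + x) ≡ x C d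
table-store M {B = B} {j} refl v≡ table x x<1+j with x ℕ.≟ j
... | yes refl = trans (≔-same M (B + j) _) v≡
... | no x≢j   = trans (≔-miss M _ (λ e → x≢j (+-cancelˡ-≡ B x j e)))
                       (table x (≤∧≢⇒< (≤-pred x<1+j) x≢j))

fillOnes-table : ∀ σ {n B} → regs σ size ≡ n → regs σ base ≡ B → regs σ one ≡ 1 →
  SameBelow B σ (eval fillOnes σ) × Table n B 0 (eval fillOnes σ)
fillOnes-table σ {n} {B} n≡ B≡ one≡ =
  for-invariant col (op (add addr base col) ⨾ op (store addr one)) σ
    (λ j ρ → SameBelow B σ ρ × Table j B 0 ρ) _ n≡ ((λ _ _ → refl) , λ _ ())
    λ j ρ j<n (fr , _) j≡ (below , table) →
      let addr≡ = cong₂ _+_ (trans (fr base _) B≡) j≡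
      in (λ a a<B → trans (below-store (cells ρ) addr≡ a a<B) (below a a<B))
       , table-store (cells ρ) {d = 0} addr≡ (trans (fr one _) one≡) table

-- Loading the old entry into `u` before overwriting it lets one column of memory suffice. Storing
-- `acc` before the addition puts into cell j the sum over the indices below j, which is the
-- hockey-stick identity for C(j, d + 1).
prefixStep prefixSums : Stmt
prefixStep = op (add addr base col) ⨾ op (load u addr) ⨾ op (store addr acc) ⨾ op (add acc acc u)
prefixSums = op (const acc 0) ⨾ for col prefixStep

-- Column d + 1 of Pascal's triangle consists of the partial sums of column d.
prefixSums-table : ∀ σ {n B d} → regs σ size ≡ n → regs σ base ≡ B → Table n B d σ →
  SameBelow B σ (eval prefixSums σ) × Table n B (suc d) (eval prefixSums σ)
prefixSums-table σ {n} {B} {d} n≡ B≡ table₀ with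
  for-invariant col prefixStep (effect (const acc 0) σ) Inv _ n≡
    (sym (k>n⇒nCk≡0 {0} {suc d} (s≤s z≤n)) , (λ _ _ → refl) , (λ _ ()) , λ x _ → table₀ x) preserve
  where
  Inv : ℕ → State → Set
  Inv j ρ = regs ρ acc ≡ j C suc d × SameBelow B σ ρ × Table j B (suc d) ρ ×
            (∀ x → j ≤ x → x < n → cells ρ (B + x) ≡ x C d)
  preserve : ∀ j ρ → j < n → Frame (for col prefixStep) (effect (const acc 0) σ) ρ → regs ρ col ≡ j →
    Inv j ρ → Inv (suc j) (next col (eval prefixStep ρ))
  preserve j ρ j<n (fr , _) j≡ (acc≡ , below , done , todo) =
      trans (cong₂ _+_ acc≡ (trans (cong (cells ρ) addr≡) (todo j ≤-refl j<n)))
        (trans (+-comm (j C suc d) (j C d)) (nCk+nC[k+1]≡[n+1]C[k+1] j d))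
    , (λ a a<B → trans (below-store (cells ρ) addr≡ a a<B) (below a a<B))
    , table-store (cells ρ) {d = suc d} addr≡ acc≡ done
    , λ x j<x x<n → trans
        (≔-miss (cells ρ) _ (λ e → <-irrefl (sym (+-cancelˡ-≡ B x j (trans e addr≡))) j<x))
        (todo x (<⇒≤ j<x) x<n)
    where
    addr≡ : regs ρ base + regs ρ col ≡ B + j
    addr≡ = cong₂ _+_ (trans (fr base _) B≡) j≡
... | _ , below , done , _ = below , done

-- The loop runs n times whatever k is; once `left` has reached zero, the remaining rounds idle.
pascalStep pascal : Stmt
pascalStep = ifPos left (prefixSums ⨾ op (sub left left one))
pascal     = for round pascalStep

pascal-table : ∀ σ {n B K} → regs σ size ≡ n → regs σ base ≡ B → regs σ one ≡ 1 → regs σ left ≡ K →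
  Table n B 0 σ → SameBelow B σ (eval pascal σ) × Table n B (n ⊓ K) (eval pascal σ)
pascal-table σ {n} {B} {K} n≡ B≡ one≡ q≡ table₀ =
  proj₂ (for-invariant round pascalStep σ Inv _ n≡ (q≡ , (λ _ _ → refl) , table₀) preserve)
  where
  Inv : ℕ → State → Set
  Inv j ρ = regs ρ left ≡ K ∸ j × SameBelow B σ ρ × Table n B (j ⊓ K) ρ
  preserve : ∀ j ρ → j < n → Frame (for round pascalStep) σ ρ → regs ρ round ≡ j →
    Inv j ρ → Inv (suc j) (next round (eval pascalStep ρ))
  preserve j ρ j<n (fr , _) j≡ (qρ≡ , below , table) = by-cases (regs ρ left) refl
    where
    by-cases : ∀ m → regs ρ left ≡ m → Inv (suc j) (next round (eval pascalStep ρ))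
    by-cases zero    eq = subst (λ ρ′ → Inv (suc j) (next round ρ′))
      (sym (eval-ifPos-zero left (prefixSums ⨾ op (sub left left one)) ρ _ eq))
      ( trans eq (sym (m≤n⇒m∸n≡0 (m≤n⇒m≤1+n K≤j)))
      , below
      , subst (λ d → Table n B d ρ)
          (trans (m≥n⇒m⊓n≡n K≤j) (sym (m≥n⇒m⊓n≡n (m≤n⇒m≤1+n K≤j)))) table)
      where
      K≤j : K ≤ j
      K≤j = m∸n≡0⇒m≤n (trans (sym qρ≡) eq)
    by-cases (suc m) eq = subst (λ ρ′ → Inv (suc j) (next round ρ′))
      (sym (eval-ifPos-suc left (prefixSums ⨾ op (sub left left one)) ρ _ eq))
      ( trans (cong₂ _∸_ (trans (eval-fresh left prefixSums ρ₁ _) qρ≡)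
                         (trans (eval-fresh one prefixSums ρ₁ _) (trans (fr one _) one≡)))
              (trans (∸-+-assoc K j 1) (cong (K ∸_) (+-comm j 1)))
      , (λ a a<B → trans (proj₁ sums a a<B) (below a a<B))
      , subst (λ d → Table n B d (eval prefixSums ρ₁))
          (trans (cong suc (m≤n⇒m⊓n≡m (<⇒≤ j<K))) (sym (m≤n⇒m⊓n≡m j<K))) (proj₂ sums))
      where
      ρ₁ : State
      ρ₁ = complement left ρ
      j<K : j < K
      j<K = ≰⇒> λ K≤j → 1+n≢0 (trans (sym eq) (trans qρ≡ (m≤n⇒m∸n≡0 K≤j)))
      sums = prefixSums-table ρ₁ (trans (fr size _) n≡) (trans (fr base _) B≡) table

thresholds : Stmt
thresholds =
  op (const u 3) ⨾ op (sub left target u) ⨾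
  -- Since k ∸ 4 is zero exactly for k ≤ 4, `1 ∸ (k ∸ 4)` is the indicator of k < 5.
  op (const u 4) ⨾ op (sub small target u) ⨾ op (sub small one small)

prepare : Stmt
prepare = op (const one 1) ⨾ squareSize ⨾ fillOnes ⨾ thresholds ⨾ pascal

record Prepared (n k : ℕ) (σ ρ : State) : Set where
  field
    size≡  : regs ρ size ≡ n
    base≡  : regs ρ base ≡ n * n
    one≡   : regs ρ one ≡ 1
    small≡ : regs ρ small ≡ 1 ∸ (k ∸ 4)
    below  : SameBelow (n * n) σ ρ
    table  : Table n (n * n) (n ⊓ (k ∸ 3)) ρ

prepare-correct : ∀ σ → Prepared (regs σ size) (regs σ target) σ (eval prepare σ)
prepare-correct σ = record
  { size≡  = eval-fresh size prepare σ _
  ; base≡  = trans (eval-fresh base (fillOnes ⨾ thresholds ⨾ pascal) σ₁ _) base₁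
  ; one≡   = eval-fresh one (squareSize ⨾ fillOnes ⨾ thresholds ⨾ pascal) (effect (const one 1) σ) _
  ; small≡ = trans (eval-fresh small pascal (eval thresholds σ₂) _)
               (cong₂ (λ a b → a ∸ (b ∸ 4)) one₂
                 (eval-fresh target (op (const one 1) ⨾ squareSize ⨾ fillOnes) σ _))
  ; below  = λ a a<B → trans (proj₁ tab a a<B) (trans (proj₁ ones a a<B)
               (cong (λ M → M a) (eval-storeFree squareSize (effect (const one 1) σ) _)))
  ; table  = proj₂ tab
  }
  where
  σ₁ σ₂ : State
  σ₁ = eval squareSize (effect (const one 1) σ)
  σ₂ = eval fillOnes σ₁
  base₁ : regs σ₁ base ≡ regs σ size * regs σ size
  base₁ = squareSize-base (effect (const one 1) σ)
  one₂ : regs σ₂ one ≡ 1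
  one₂ = eval-fresh one (squareSize ⨾ fillOnes) (effect (const one 1) σ) _
  ones = fillOnes-table σ₁ (eval-fresh size (op (const one 1) ⨾ squareSize) σ _) base₁
           (eval-fresh one squareSize (effect (const one 1) σ) _)
  tab = pascal-table (eval thresholds σ₂)
    (eval-fresh size (op (const one 1) ⨾ squareSize ⨾ fillOnes ⨾ thresholds) σ _)
    (trans (eval-fresh base (fillOnes ⨾ thresholds) σ₁ _) base₁)
    one₂ (cong (_∸ 3) (eval-fresh target (op (const one 1) ⨾ squareSize ⨾ fillOnes) σ _))
    (proj₂ ones)

-- Adding `size` once per round keeps the offset of matrix row x at x times n without a
-- multiplication.
overRows : ℕ → ℕ → Stmt → Stmt
overRows x row s = op (const row 0) ⨾ for x (s ⨾ op (add row row size))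

overRows-sum : ∀ x row s σ {n} (g : ℕ → ℕ) → WellFormed (overRows x row s) →
  Fresh row s → Distinct row x → Distinct row τ → Distinct total x → Distinct total row →
  regs σ size ≡ n →
  (∀ j ρ → j < n → Frame (overRows x row s) σ ρ → regs ρ x ≡ j → regs ρ row ≡ j * n →
    regs (eval s ρ) total ≡ regs ρ total + g j) →
  regs (eval (overRows x row s) σ) total ≡ regs σ total + ∑ n g
overRows-sum x row s σ {n} g (_ , w@(_ , (fN , fN′) , _ , N≢x , _) , N≢row) frow row≢x row≢τ
  total≢x total≢row n≡ body =
  proj₁ (for-invariant x (s ⨾ op (add row row size)) σ₀
    (λ j ρ → regs ρ total ≡ regs σ total + ∑ j g × regs ρ row ≡ j * n)
    w (trans (effect-fresh size (const row 0) σ N≢row) n≡)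
    ( trans (init-fresh total x σ₀ _ total≢x)
        (trans (effect-fresh total (const row 0) σ total≢row) (sym (+-identityʳ _)))
    , trans (init-fresh row x σ₀ row≢τ row≢x) (≔-same (regs σ) row 0))
    λ j ρ j<n (fr , fc) j≡ (total≡ , row≡) →
      let ρ₁ = effect (add row row size) (eval s ρ)
          frame : Frame (overRows x row s) σ ρ
          frame = (λ r (r≢row , d) → trans (fr r d) (≔-other (regs σ) 0 r≢row)) , λ (_ , f) → fc f
      in
      ( trans (next-fresh total x ρ₁ _ total≢x)
          (trans (effect-fresh total (add row row size) (eval s ρ) total≢row)
          (trans (body j ρ j<n frame j≡ row≡)
          (trans (cong (_+ g j) total≡) (+-assoc (regs σ total) (∑ j g) (g j)))))
      , trans (next-fresh row x ρ₁ row≢τ row≢x)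
          (trans (≔-same (regs (eval s ρ)) row _)
          (trans (cong₂ _+_ (trans (eval-fresh row s ρ frow) row≡)
                   (trans (eval-fresh size s ρ fN)
                     (trans (proj₁ frame size (N≢row , _ , N≢x , fN , fN′)) n≡)))
          (+-comm (j * n) n)))))
  where
  σ₀ : State
  σ₀ = effect (const row 0) σ

-- On 0-1 values truncated subtraction is "and not": the summand is 1 exactly if bx is an edge while
-- tx and sx are not.
candidates : ℕ → (ℕ → ℕ) → ℕ → ℕ → ℕ → ℕ
candidates n M b t s = ∑ n λ x → (M (b * n + x) ∸ M (t * n + x)) ∸ M (s * n + x)

candidateStep countCandidates : Stmt
candidateStep =
  op (add addr rowB ix) ⨾ op (load u addr) ⨾
  op (add addr rowT ix) ⨾ op (load v addr) ⨾ op (sub u u v) ⨾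
  op (add addr rowS ix) ⨾ op (load v addr) ⨾ op (sub u u v) ⨾
  op (add cnt cnt u)
countCandidates = op (const cnt 0) ⨾ for ix candidateStep

countCandidates-correct : ∀ σ {n b t s} → regs σ size ≡ n →
  regs σ rowB ≡ b * n → regs σ rowT ≡ t * n → regs σ rowS ≡ s * n →
  regs (eval countCandidates σ) cnt ≡ candidates n (cells σ) b t s
countCandidates-correct σ {n} {b} {t} {s} n≡ B≡ T≡ S≡ =
  for-invariant ix candidateStep (effect (const cnt 0) σ)
    (λ j ρ → regs ρ cnt ≡ ∑ j λ x → (M (b * n + x) ∸ M (t * n + x)) ∸ M (s * n + x))
    _ n≡ refl
    λ j ρ _ (fr , fc) j≡ cnt≡ →
      let entry : ∀ {r r′} → r ≡ r′ → cells ρ (r + regs ρ ix) ≡ M (r′ + j)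
          entry r≡ = cong₂ (λ m a → m a) (fc _) (cong₂ _+_ r≡ j≡)
      in cong₂ _+_ cnt≡ (cong₂ _∸_
           (cong₂ _∸_ (entry (trans (fr rowB _) B≡)) (entry (trans (fr rowT _) T≡)))
           (entry (trans (fr rowS _) S≡)))
  where
  M : ℕ → ℕ
  M = cells σ

accumulate : Stmt
accumulate = ifPos u (op (add addr base cnt) ⨾ op (load v addr) ⨾ op (add total total v))

infix 4 _guards_

-- The arithmetic counterpart of `ifPos`; for a guard in {0, 1} it is the product.
_guards_ : ℕ → ℕ → ℕ
zero  guards w = 0
suc _ guards w = w

accumulate-total : ∀ σ →
  regs (eval accumulate σ) total ≡
  regs σ total + (regs σ u guards cells σ (regs σ base + regs σ cnt))
accumulate-total σ = by-cases (regs σ u) refl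
  where
  body : Stmt
  body = op (add addr base cnt) ⨾ op (load v addr) ⨾ op (add total total v)
  by-cases : ∀ m → regs σ u ≡ m →
    regs (eval accumulate σ) total ≡
    regs σ total + (regs σ u guards cells σ (regs σ base + regs σ cnt))
  by-cases zero    e rewrite eval-ifPos-zero u body σ _ e | e = sym (+-identityʳ _)
  by-cases (suc m) e rewrite eval-ifPos-suc u body σ _ e | e = refl

-- On a 0-1 matrix this is 1 if bt and ts are edges and bs is not, and 0 otherwise.  The
-- degenerate case b = s passes the test but has no candidates.
isPath : ℕ → (ℕ → ℕ) → ℕ → ℕ → ℕ → ℕ
isPath n M b t s = ((M (b * n + t) + M (t * n + s)) ∸ 1) ∸ M (b * n + s)

-- The path test is at most 1 on a 0-1 matrix, so subtracting `z` = 1 switches off every summand.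
-- This is how the case k < 5 is answered by the same loops.
triples : ℕ → ℕ → (ℕ → ℕ) → ℕ
triples n z M = ∑ n λ b → ∑ n λ t → ∑ n λ s →
  isPath n M b t s ∸ z guards M (n * n + candidates n M b t s)

testPath addTriple countTriples : Stmt
testPath =
  op (add addr rowB it) ⨾ op (load u addr) ⨾
  op (add addr rowT is) ⨾ op (load v addr) ⨾ op (add u u v) ⨾ op (sub u u one) ⨾
  op (add addr rowB is) ⨾ op (load v addr) ⨾ op (sub u u v) ⨾ op (sub u u small)
addTriple = countCandidates ⨾ testPath ⨾ accumulate
countTriples =
  op (const total 0) ⨾ overRows ib rowB (overRows it rowT (overRows is rowS addTriple))

addTriple-total : ∀ σ {n z b t s} → regs σ size ≡ n → regs σ base ≡ n * n →
  regs σ one ≡ 1 → regs σ small ≡ z → regs σ it ≡ t → regs σ is ≡ s →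
  regs σ rowB ≡ b * n → regs σ rowT ≡ t * n → regs σ rowS ≡ s * n →
  regs (eval addTriple σ) total ≡ regs σ total +
    (isPath n (cells σ) b t s ∸ z guards cells σ (n * n + candidates n (cells σ) b t s))
addTriple-total σ {n} {z} {b} {t} {s} n≡ base≡ one≡ z≡ t≡ s≡ B≡ T≡ S≡ =
  trans (accumulate-total (eval testPath σ₁))
    (cong₂ _+_ (eval-fresh total countCandidates σ _)
      (cong₂ _guards_
        (cong₂ _∸_
          (cong₂ _∸_
            (cong₂ _∸_ (cong₂ _+_ (entry rowB it _ _ B≡ t≡) (entry rowT is _ _ T≡ s≡)) (keep one _ one≡))
            (entry rowB is _ _ B≡ s≡))
          (keep small _ z≡))
        (cong₂ (λ m a → m a) same
          (cong₂ _+_ (keep base _ base≡) (countCandidates-correct σ {n} {b} {t} {s} n≡ B≡ T≡ S≡)))))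
  where
  σ₁ : State
  σ₁ = eval countCandidates σ
  same : cells σ₁ ≡ cells σ
  same = eval-storeFree countCandidates σ _
  keep : ∀ r {w} → Fresh r countCandidates → regs σ r ≡ w → regs σ₁ r ≡ w
  keep r f e = trans (eval-fresh r countCandidates σ f) e
  entry : ∀ r r′ {w w′} → Fresh r countCandidates → Fresh r′ countCandidates →
    regs σ r ≡ w → regs σ r′ ≡ w′ → cells σ₁ (regs σ₁ r + regs σ₁ r′) ≡ cells σ (w + w′)
  entry r r′ f f′ e e′ = cong₂ (λ m a → m a) same (cong₂ _+_ (keep r f e) (keep r′ f′ e′))

countTriples-total : ∀ σ {n z} → regs σ size ≡ n → regs σ base ≡ n * n →
  regs σ one ≡ 1 → regs σ small ≡ z →
  regs (eval countTriples σ) total ≡ triples n z (cells σ)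
countTriples-total σ {n} {z} n≡ base≡ one≡ z≡ =
  overRows-sum ib rowB (overRows it rowT (overRows is rowS addTriple)) (effect (const total 0) σ) _
    _ _ _ _ _ _ n≡ λ b ρ₁ _ (fr₁ , fc₁) b≡ B≡ →
  overRows-sum it rowT (overRows is rowS addTriple) ρ₁ _
    _ _ _ _ _ _ (trans (fr₁ size _) n≡) λ t ρ₂ _ (fr₂ , fc₂) t≡ T≡ →
  overRows-sum is rowS addTriple ρ₂ _
    _ _ _ _ _ _ (trans (fr₂ size _) (trans (fr₁ size _) n≡)) λ s ρ₃ _ (fr₃ , fc₃) s≡ S≡ →
  trans
    (addTriple-total ρ₃ {n} {z} {b} {t} {s}
      (trans (fr₃ size _) (trans (fr₂ size _) (trans (fr₁ size _) n≡)))
      (trans (fr₃ base _) (trans (fr₂ base _) (trans (fr₁ base _) base≡)))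
      (trans (fr₃ one _) (trans (fr₂ one _) (trans (fr₁ one _) one≡)))
      (trans (fr₃ small _) (trans (fr₂ small _) (trans (fr₁ small _) z≡)))
      (trans (fr₃ it _) t≡) s≡
      (trans (fr₃ rowB _) (trans (fr₂ rowB _) B≡)) (trans (fr₃ rowT _) T≡) S≡)
    (cong (λ M → regs ρ₃ total + (isPath n M b t s ∸ z guards M (n * n + candidates n M b t s)))
      (trans (fc₃ _) (trans (fc₂ _) (fc₁ _))))

countScorpions : Stmt
-- Register 0 is both `size` and the output register. Only the very last instruction may overwrite
-- it, and `WellFormed` permits this because it asks `Fresh size` of the first part of a composition
-- alone. Adding 0 copies the result.
countScorpions = prepare ⨾ countTriples ⨾ op (const addr 0) ⨾ op (add size total addr)

countScorpions-wellFormed : WellFormed countScorpions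
countScorpions-wellFormed = _

countScorpions-output : ∀ σ →
  regs (eval countScorpions σ) size ≡
  triples (regs σ size) (1 ∸ (regs σ target ∸ 4)) (cells (eval prepare σ))
countScorpions-output σ =
  trans (+-identityʳ _) (countTriples-total (eval prepare σ) size≡ base≡ one≡ small≡)
  where open Prepared (prepare-correct σ)

-- Subsets with prescribed and optional elements

data Kind : Set where
  must may never : Kind

Allowed : Kind → Side → Set
Allowed must  inside  = ⊤
Allowed must  outside = ⊥
Allowed may   _       = ⊤
Allowed never inside  = ⊥
Allowed never outside = ⊤

mustBit mayBit : Kind → ℕ
mustBit must = 1
mustBit _    = 0
mayBit  may  = 1
mayBit  _    = 0

sumFin : ∀ {n} → (Fin n → ℕ) → ℕ
sumFin {zero}  f = 0
sumFin {suc n} f = f zero + sumFin (f ∘ suc)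

sumFin-cong : ∀ {n} {f g : Fin n → ℕ} → (∀ x → f x ≡ g x) → sumFin f ≡ sumFin g
sumFin-cong {zero}  e = refl
sumFin-cong {suc n} e = cong₂ _+_ (e zero) (sumFin-cong (e ∘ suc))

sumFin-+ : ∀ {n} (f g : Fin n → ℕ) → sumFin (λ x → f x + g x) ≡ sumFin f + sumFin g
sumFin-+ {zero}  f g = refl
sumFin-+ {suc n} f g =
  trans (cong (f zero + g zero +_) (sumFin-+ (f ∘ suc) (g ∘ suc)))
    (interchange +-commutativeSemigroup (f zero) (g zero) (sumFin (f ∘ suc)) (sumFin (g ∘ suc)))

sumFin-0 : ∀ n → sumFin {n} (λ _ → 0) ≡ 0
sumFin-0 zero    = refl
sumFin-0 (suc n) = sumFin-0 n

sumFin-≤ : ∀ {n} {f : Fin n → ℕ} → (∀ x → f x ≤ 1) → sumFin f ≤ n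
sumFin-≤ {zero}  f≤1 = z≤n
sumFin-≤ {suc n} f≤1 = +-mono-≤ (f≤1 zero) (sumFin-≤ (f≤1 ∘ suc))

sumFin-< : ∀ {n} {f : Fin n → ℕ} y → (∀ x → f x ≤ 1) → f y ≡ 0 → sumFin f < n
sumFin-< zero    f≤1 e rewrite e = s≤s (sumFin-≤ (f≤1 ∘ suc))
sumFin-< {suc n} {f} (suc y) f≤1 e =
  ≤-trans (≤-reflexive (sym (+-suc (f zero) _))) (+-mono-≤ (f≤1 zero) (sumFin-< y (f≤1 ∘ suc) e))

δ : ∀ {n} → Fin n → Fin n → ℕ
δ y x = if does (x Fin.≟ y) then 1 else 0

sum-δ : ∀ {n} (y : Fin n) → sumFin (δ y) ≡ 1
sum-δ {suc n} zero    = cong suc (sumFin-0 n)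
sum-δ         (suc y) = sum-δ y

skip pick : ∀ {n} → (ℕ → List (Subset n)) → ℕ → List (Subset (suc n))
skip F k       = map (outside ∷_) (F k)
pick F zero    = []
pick F (suc k) = map (inside ∷_) (F k)

extend : ∀ {n} → Kind → (ℕ → List (Subset n)) → ℕ → List (Subset (suc n))
extend never F k = skip F k
extend must  F k = pick F k
extend may   F k = skip F k ++ pick F k

fillings : ∀ {n} → (Fin n → Kind) → ℕ → List (Subset n)
fillings {zero}  κ zero    = [] ∷ []
fillings {zero}  κ (suc k) = []
fillings {suc n} κ k       = extend (κ zero) (fillings (κ ∘ suc)) k

Fits : ∀ {n} → (Fin n → Kind) → ℕ → Subset n → Set
Fits κ k X = ∣ X ∣ ≡ k × (∀ x → Allowed (κ x) (lookup X x))

∈-skip⁻ : ∀ {n} (F : ℕ → List (Subset n)) k {a X} → (a ∷ X) ∈ skip F k →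
  a ≡ outside × ∃ λ l → X ∈ F l × (∣ X ∣ ≡ l → ∣ a ∷ X ∣ ≡ k)
∈-skip⁻ F k h with ∈-map⁻ (outside ∷_) h
... | _ , X∈ , refl = refl , k , X∈ , λ e → e

∈-pick⁻ : ∀ {n} (F : ℕ → List (Subset n)) k {a X} → (a ∷ X) ∈ pick F k →
  a ≡ inside × ∃ λ l → X ∈ F l × (∣ X ∣ ≡ l → ∣ a ∷ X ∣ ≡ k)
∈-pick⁻ F (suc k) h with ∈-map⁻ (inside ∷_) h
... | _ , X∈ , refl = refl , k , X∈ , cong suc

∈-extend⁻ : ∀ {n} κ (F : ℕ → List (Subset n)) k {a X} → (a ∷ X) ∈ extend κ F k →
  Allowed κ a × ∃ λ l → X ∈ F l × (∣ X ∣ ≡ l → ∣ a ∷ X ∣ ≡ k)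
∈-extend⁻ never F k h with ∈-skip⁻ F k h
... | refl , h′ = tt , h′
∈-extend⁻ must  F k h with ∈-pick⁻ F k h
... | refl , h′ = tt , h′
∈-extend⁻ may   F k h with ∈-++⁻ (skip F k) h
... | inj₁ h′ = tt , proj₂ (∈-skip⁻ F k h′)
... | inj₂ h′ = tt , proj₂ (∈-pick⁻ F k h′)

∈-extend⁺ : ∀ {n} κ (F : ℕ → List (Subset n)) a {X} → Allowed κ a → X ∈ F ∣ X ∣ →
  (a ∷ X) ∈ extend κ F ∣ a ∷ X ∣
∈-extend⁺ must  F inside  _ X∈ = ∈-map⁺ (inside ∷_) X∈
∈-extend⁺ never F outside _ X∈ = ∈-map⁺ (outside ∷_) X∈
∈-extend⁺ may   F inside  {X} _ X∈ = ∈-++⁺ʳ (skip F (suc ∣ X ∣)) (∈-map⁺ (inside ∷_) X∈)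
∈-extend⁺ may   F outside _ X∈ = ∈-++⁺ˡ (∈-map⁺ (outside ∷_) X∈)

∈-fillings⁻ : ∀ {n} (κ : Fin n → Kind) k X → X ∈ fillings κ k → Fits κ k X
∈-fillings⁻ {zero}  κ zero [] _ = refl , λ ()
∈-fillings⁻ {suc n} κ k (a ∷ X) h with ∈-extend⁻ (κ zero) (fillings (κ ∘ suc)) k h
... | ok , l , X∈ , size≡ with ∈-fillings⁻ (κ ∘ suc) l X X∈
...   | ∣X∣≡l , oks = size≡ ∣X∣≡l , λ { zero → ok ; (suc x) → oks x }

∈-fillings⁺ : ∀ {n} (κ : Fin n → Kind) k X → Fits κ k X → X ∈ fillings κ k
∈-fillings⁺ {zero}  κ _ []      (refl , _)  = here refl
∈-fillings⁺ {suc n} κ _ (a ∷ X) (refl , ok) =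
  ∈-extend⁺ (κ zero) (fillings (κ ∘ suc)) a (ok zero)
    (∈-fillings⁺ (κ ∘ suc) ∣ X ∣ X (refl , ok ∘ suc))

skip-unique : ∀ {n} (F : ℕ → List (Subset n)) k → (∀ l → Unique (F l)) → Unique (skip F k)
skip-unique F k uF = Unique.map⁺ ∷-injectiveʳ (uF k)

pick-unique : ∀ {n} (F : ℕ → List (Subset n)) k → (∀ l → Unique (F l)) → Unique (pick F k)
pick-unique F zero    uF = []
pick-unique F (suc k) uF = Unique.map⁺ ∷-injectiveʳ (uF k)

extend-unique : ∀ {n} κ (F : ℕ → List (Subset n)) k → (∀ l → Unique (F l)) → Unique (extend κ F k)
extend-unique never F k uF = skip-unique F k uF
extend-unique must  F k uF = pick-unique F k uF
extend-unique may   F k uF = Unique.++⁺ (skip-unique F k uF) (pick-unique F k uF) disjoint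
  where
  disjoint : ∀ {X} → ¬ (X ∈ skip F k × X ∈ pick F k)
  disjoint {a ∷ _} (h , h′) with trans (sym (proj₁ (∈-skip⁻ F k h))) (proj₁ (∈-pick⁻ F k h′))
  ... | ()

fillings-unique : ∀ {n} (κ : Fin n → Kind) k → Unique (fillings κ k)
fillings-unique {zero}  κ zero    = [] ∷ []
fillings-unique {zero}  κ (suc k) = []
fillings-unique {suc n} κ k       = extend-unique (κ zero) _ k (fillings-unique (κ ∘ suc))

length-skip : ∀ {n} (F : ℕ → List (Subset n)) k → length (skip F k) ≡ length (F k)
length-skip F k = length-map (outside ∷_) (F k)

length-pick : ∀ {n} (F : ℕ → List (Subset n)) k → length (pick F (suc k)) ≡ length (F k)
length-pick F k = length-map (inside ∷_) (F k)

-- Used for the boundary case of the exact count: when only the prescribed elements fit, choosing an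
-- optional one leaves too little room for them.
length-fillings-few : ∀ {n} (κ : Fin n → Kind) k → k < sumFin (mustBit ∘ κ) →
  length (fillings κ k) ≡ 0
length-fillings-few {suc n} κ k k< = go (κ zero) k k<
  where
  F = fillings (κ ∘ suc)
  few : ∀ l → l < sumFin (mustBit ∘ κ ∘ suc) → length (F l) ≡ 0
  few = length-fillings-few (κ ∘ suc)
  few-pick : ∀ k → k < suc (sumFin (mustBit ∘ κ ∘ suc)) → length (pick F k) ≡ 0
  few-pick zero    _        = refl
  few-pick (suc k) (s≤s k<) = trans (length-pick F k) (few k k<)
  go : ∀ a k → k < mustBit a + sumFin (mustBit ∘ κ ∘ suc) → length (extend a F k) ≡ 0
  go never k k< = trans (length-skip F k) (few k k<)
  go must  k k< = few-pick k k<
  go may   k k< = trans (length-++ (skip F k))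
    (cong₂ _+_ (trans (length-skip F k) (few k k<)) (few-pick k (m≤n⇒m≤1+n k<)))

-- Pascal's rule, read combinatorially: an optional element is either skipped, leaving m free
-- places, or picked, leaving m - 1.
length-fillings : ∀ {n} (κ : Fin n → Kind) m →
  length (fillings κ (sumFin (mustBit ∘ κ) + m)) ≡ sumFin (mayBit ∘ κ) C m
length-fillings {zero}  κ zero    = refl
length-fillings {zero}  κ (suc m) = sym (k>n⇒nCk≡0 {0} {suc m} (s≤s z≤n))
length-fillings {suc n} κ m       = go (κ zero) m
  where
  F = fillings (κ ∘ suc)
  M c : ℕ
  M = sumFin (mustBit ∘ κ ∘ suc)
  c = sumFin (mayBit ∘ κ ∘ suc)
  rest : ∀ m → length (F (M + m)) ≡ c C m
  rest = length-fillings (κ ∘ suc)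
  no-spare : ∀ k → k ≡ M → length (pick F k) ≡ 0
  no-spare zero    _ = refl
  no-spare (suc k) e =
    trans (length-pick F k) (length-fillings-few (κ ∘ suc) k (≤-reflexive e))
  go-may : ∀ m → length (skip F (M + m)) + length (pick F (M + m)) ≡ suc c C m
  go-may zero    = cong₂ _+_ (trans (length-skip F (M + 0)) (rest 0)) (no-spare (M + 0) (+-identityʳ M))
  go-may (suc m) = begin
    length (skip F (M + suc m)) + length (pick F (M + suc m))
      ≡⟨ cong₂ _+_ (trans (length-skip F (M + suc m)) (rest (suc m)))
           (trans (cong (length ∘ pick F) (+-suc M m)) (trans (length-pick F (M + m)) (rest m))) ⟩
    c C suc m + c C m
      ≡⟨ +-comm (c C suc m) (c C m) ⟩
    c C m + c C suc m
      ≡⟨ nCk+nC[k+1]≡[n+1]C[k+1] c m ⟩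
    suc c C suc m ∎
    where open ≡-Reasoning
  go : ∀ a m → length (extend a F (mustBit a + M + m)) ≡ (mayBit a + c) C m
  go never m = trans (length-skip F (M + m)) (rest m)
  go must  m = trans (length-pick F (M + m)) (rest m)
  go may   m = trans (length-++ (skip F (M + m))) (go-may m)

-- Disjoint unions

⋃ : ∀ {n} {A : Set} → (Fin n → List A) → List A
⋃ L = concat (tabulate L)

module _ {A : Set} where
  ∈-⋃⁺ : ∀ {n} (L : Fin n → List A) i {x} → x ∈ L i → x ∈ ⋃ L
  ∈-⋃⁺ L i h = ∈-concat⁺′ h (∈-tabulate⁺ {f = L} i)

  ∈-⋃⁻ : ∀ {n} (L : Fin n → List A) {x} → x ∈ ⋃ L → ∃ λ i → x ∈ L i
  ∈-⋃⁻ L h with ∈-concat⁻′ (tabulate L) h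
  ... | _ , x∈ , L∈ with ∈-tabulate⁻ {f = L} L∈
  ...   | i , refl = i , x∈

  ⋃-unique : ∀ {n} (L : Fin n → List A) → (∀ i → Unique (L i)) →
    (∀ i j x → x ∈ L i → x ∈ L j → i ≡ j) → Unique (⋃ L)
  ⋃-unique L uL same = Unique.concat⁺ (All.tabulate⁺ {f = L} uL)
    (AllPairs.tabulate⁺ {f = L} λ {i} {j} i≢j {x} (x∈ , x∈′) → i≢j (same i j x x∈ x∈′))

  length-⋃ : ∀ {n} (L : Fin n → List A) → length (⋃ L) ≡ sumFin (length ∘ L)
  length-⋃ {zero}  L = refl
  length-⋃ {suc n} L = trans (length-++ (L zero)) (cong (length (L zero) +_) (length-⋃ (L ∘ suc)))

-- Vertex sets inducing scorpions

_∋_ : ∀ {n} → Subset n → Fin n → Set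
X ∋ x = lookup X x ≡ inside

lookup-members : ∀ {n} (X : Subset n) i → X ∋ lookup (members X) i
lookup-members (inside  ∷ X) zero    = refl
lookup-members (inside  ∷ X) (suc i) =
  trans (cong (lookup (inside ∷ X)) (lookup-map i suc (members X))) (lookup-members X i)
lookup-members (outside ∷ X) i       =
  trans (cong (lookup (outside ∷ X)) (lookup-map i suc (members X))) (lookup-members X i)

members-complete : ∀ {n} (X : Subset n) x → X ∋ x → ∃ λ i → lookup (members X) i ≡ x
members-complete (inside  ∷ X) zero    _ = zero , refl
members-complete (inside  ∷ X) (suc x) h with members-complete X x h
... | i , e = suc i , trans (lookup-map i suc (members X)) (cong suc e)
members-complete (outside ∷ X) (suc x) h with members-complete X x h
... | i , e = i , trans (lookup-map i suc (members X)) (cong suc e)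

members-injective : ∀ {n} (X : Subset n) → Injective _≡_ _≡_ (lookup (members X))
members-injective (inside ∷ X) {zero}  {zero}  _ = refl
members-injective (inside ∷ X) {zero}  {suc j} e =
  contradiction (trans e (lookup-map j suc (members X))) λ ()
members-injective (inside ∷ X) {suc i} {zero}  e =
  contradiction (trans (sym e) (lookup-map i suc (members X))) λ ()
members-injective (inside ∷ X) {suc i} {suc j} e = cong suc (members-injective X
  (Fin.suc-injective (trans (sym (lookup-map i suc (members X)))
    (trans e (lookup-map j suc (members X))))))
members-injective (outside ∷ X) {i} {j} e = members-injective X
  (Fin.suc-injective (trans (sym (lookup-map i suc (members X)))
    (trans e (lookup-map j suc (members X)))))

-- Meant for two enumerations of one vertex set X: the increasing one behind `induced`, and the one
-- listing b, t, s before the rest. Matching them gives the bijection of the required isomorphism.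
sameImage : ∀ {A B C : Set} (f : A → C) (g : B → C) →
  Injective _≡_ _≡_ f → Injective _≡_ _≡_ g →
  (∀ a → ∃ λ b → g b ≡ f a) → (∀ b → ∃ λ a → f a ≡ g b) →
  Σ (A ↔ B) λ h → ∀ a → g (Inverse.to h a) ≡ f a
sameImage f g f-inj g-inj fg gf =
  mk↔ₛ′ (proj₁ ∘ fg) (proj₁ ∘ gf)
    (λ b → g-inj (trans (proj₂ (fg (proj₁ (gf b)))) (proj₂ (gf b))))
    (λ a → f-inj (trans (proj₂ (gf (proj₁ (fg a)))) (proj₂ (fg a))))
  , proj₂ ∘ fg

does⇒ : ∀ {P : Set} (P? : Dec P) → does P? ≡ true → P
does⇒ (yes p) _ = p

module _ {n} (G : Graph n) where

  Path : Fin n → Fin n → Fin n → Set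
  Path b t s = adj G b t ≡ true × adj G t s ≡ true × adj G b s ≡ false × b ≢ s

  path? : ∀ b t s → Dec (Path b t s)
  path? b t s = (adj G b t Bool.≟ true) ×-dec (adj G t s Bool.≟ true) ×-dec
                (adj G b s Bool.≟ false) ×-dec ¬? (b Fin.≟ s)

  Candidate : Fin n → Fin n → Fin n → Fin n → Set
  Candidate b t s x = adj G b x ≡ true × adj G t x ≡ false × adj G s x ≡ false

  candidate? : ∀ b t s x → Dec (Candidate b t s x)
  candidate? b t s x =
    (adj G b x Bool.≟ true) ×-dec (adj G t x Bool.≟ false) ×-dec (adj G s x Bool.≟ false)

  adj⇒≢ : ∀ {x y} → adj G x y ≡ true → x ≢ y
  adj⇒≢ {x} e refl = contradiction (trans (sym e) (adj-irrefl G x)) λ ()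

  -- The bound on |X| is kept out, so that for a given path this amounts to a separate condition on
  -- each vertex, as the counting of fillings demands. The bound enters with `IsScorpion` and with
  -- uniqueness.
  record ScorpionAt (X : Subset n) (b t s : Fin n) : Set where
    field
      path   : Path b t s
      b∈     : X ∋ b
      t∈     : X ∋ t
      s∈     : X ∋ s
      others : ∀ x → X ∋ x → x ≢ b → x ≢ t → x ≢ s → Candidate b t s x

    bt : adj G b t ≡ true
    bt = proj₁ path

    ts : adj G t s ≡ true
    ts = proj₁ (proj₂ path)

    bs : adj G b s ≡ false
    bs = proj₁ (proj₂ (proj₂ path))

    b≢t : b ≢ t
    b≢t = adj⇒≢ bt

    t≢s : t ≢ s
    t≢s = adj⇒≢ ts

    b≢s : b ≢ s
    b≢s = proj₂ (proj₂ (proj₂ path))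

    Other : Fin n → Set
    Other x = X ∋ x × x ≢ b × x ≢ t × x ≢ s

    other? : ∀ x → Dec (Other x)
    other? x = (lookup X x Bool.≟ inside) ×-dec ¬? (x Fin.≟ b) ×-dec ¬? (x Fin.≟ t) ×-dec ¬? (x Fin.≟ s)

    -- These vertices play the part of H′ in the definition of a scorpion.
    body : Subset n
    body = Vec.tabulate (does ∘ other?)

    body⁺ : ∀ x → Other x → body ∋ x
    body⁺ x o = trans (lookup∘tabulate (does ∘ other?) x) (dec-true (other? x) o)

    body⁻ : ∀ x → body ∋ x → Other x
    body⁻ x h = does⇒ (other? x) (trans (sym (lookup∘tabulate (does ∘ other?) x)) h)

    bodyVertex : ∀ i → Other (lookup (members body) i)
    bodyVertex i = body⁻ _ (lookup-members body i)

    bodyCandidate : ∀ i → Candidate b t s (lookup (members body) i)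
    bodyCandidate i with bodyVertex i
    ... | x∈ , x≢b , x≢t , x≢s = others _ x∈ x≢b x≢t x≢s

    vertex : Fin (3 + ∣ body ∣) → Fin n
    vertex vb     = b
    vertex vt     = t
    vertex vs     = s
    vertex (vH i) = lookup (members body) i

    vertex∈ : ∀ p → X ∋ vertex p
    vertex∈ vb     = b∈
    vertex∈ vt     = t∈
    vertex∈ vs     = s∈
    vertex∈ (vH i) = proj₁ (bodyVertex i)

    vertex-complete : ∀ x → X ∋ x → ∃ λ p → vertex p ≡ x
    vertex-complete x x∈ with x Fin.≟ b | x Fin.≟ t | x Fin.≟ s
    ... | yes refl | _        | _        = vb , refl
    ... | no _     | yes refl | _        = vt , refl
    ... | no _     | no _     | yes refl = vs , refl
    ... | no x≢b   | no x≢t   | no x≢s   with members-complete body x (body⁺ x (x∈ , x≢b , x≢t , x≢s))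
    ...   | i , e = vH i , e

    vertex-injective : Injective _≡_ _≡_ vertex
    vertex-injective {vb}   {vb}   e = refl
    vertex-injective {vb}   {vt}   e = contradiction e b≢t
    vertex-injective {vb}   {vs}   e = contradiction e b≢s
    vertex-injective {vb}   {vH j} e = contradiction (sym e) (proj₁ (proj₂ (bodyVertex j)))
    vertex-injective {vt}   {vb}   e = contradiction (sym e) b≢t
    vertex-injective {vt}   {vt}   e = refl
    vertex-injective {vt}   {vs}   e = contradiction e t≢s
    vertex-injective {vt}   {vH j} e = contradiction (sym e) (proj₁ (proj₂ (proj₂ (bodyVertex j))))
    vertex-injective {vs}   {vb}   e = contradiction (sym e) b≢s
    vertex-injective {vs}   {vt}   e = contradiction (sym e) t≢s
    vertex-injective {vs}   {vs}   e = refl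
    vertex-injective {vs}   {vH j} e = contradiction (sym e) (proj₂ (proj₂ (proj₂ (bodyVertex j))))
    vertex-injective {vH i} {vb}   e = contradiction e (proj₁ (proj₂ (bodyVertex i)))
    vertex-injective {vH i} {vt}   e = contradiction e (proj₁ (proj₂ (proj₂ (bodyVertex i))))
    vertex-injective {vH i} {vs}   e = contradiction e (proj₂ (proj₂ (proj₂ (bodyVertex i))))
    vertex-injective {vH i} {vH j} e = cong (λ k → vH k) (members-injective body e)

    vertex-adj : ∀ p q → adj G (vertex p) (vertex q) ≡ adj (addBTS (induced G body)) p q
    vertex-adj vb     vb     = adj-irrefl G b
    vertex-adj vb     vt     = bt
    vertex-adj vb     vs     = bs
    vertex-adj vb     (vH j) = proj₁ (bodyCandidate j)
    vertex-adj vt     vb     = trans (adj-sym G t b) bt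
    vertex-adj vt     vt     = adj-irrefl G t
    vertex-adj vt     vs     = ts
    vertex-adj vt     (vH j) = proj₁ (proj₂ (bodyCandidate j))
    vertex-adj vs     vb     = trans (adj-sym G s b) bs
    vertex-adj vs     vt     = trans (adj-sym G s t) ts
    vertex-adj vs     vs     = adj-irrefl G s
    vertex-adj vs     (vH j) = proj₂ (proj₂ (bodyCandidate j))
    vertex-adj (vH i) vb     = trans (adj-sym G _ b) (proj₁ (bodyCandidate i))
    vertex-adj (vH i) vt     = trans (adj-sym G _ t) (proj₁ (proj₂ (bodyCandidate i)))
    vertex-adj (vH i) vs     = trans (adj-sym G _ s) (proj₂ (proj₂ (bodyCandidate i)))
    vertex-adj (vH i) (vH j) = refl

    relabelling : Σ (Fin ∣ X ∣ ↔ Fin (3 + ∣ body ∣)) λ h →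
      ∀ i → vertex (Inverse.to h i) ≡ lookup (members X) i
    relabelling = sameImage (lookup (members X)) vertex (members-injective X) vertex-injective
      (λ i → vertex-complete _ (lookup-members X i)) (λ p → members-complete X _ (vertex∈ p))

    2≤body : 5 ≤ ∣ X ∣ → 2 ≤ ∣ body ∣
    2≤body 5≤ = +-cancelˡ-≤ 3 2 ∣ body ∣ (≤-trans 5≤ (≤-reflexive (↔⇒≡ (proj₁ relabelling))))

    isScorpion : 5 ≤ ∣ X ∣ → IsScorpion (induced G X)
    isScorpion 5≤ = ∣ body ∣ , induced G body , 2≤body 5≤ , proj₁ relabelling , λ i j →
      trans (sym (cong₂ (adj G) (proj₂ relabelling i) (proj₂ relabelling j)))
        (vertex-adj (Inverse.to (proj₁ relabelling) i) (Inverse.to (proj₁ relabelling) j))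

    b-nonadjacent : ∀ {x} → X ∋ x → adj G b x ≡ false → x ≡ b ⊎ x ≡ s
    b-nonadjacent {x} x∈ bx with x Fin.≟ b | x Fin.≟ t | x Fin.≟ s
    ... | yes e  | _        | _      = inj₁ e
    ... | no _   | yes refl | _      = contradiction (trans (sym bt) bx) λ ()
    ... | no _   | no _     | yes e  = inj₂ e
    ... | no x≢b | no x≢t   | no x≢s =
      contradiction (trans (sym (proj₁ (others x x∈ x≢b x≢t x≢s))) bx) λ ()

    s-neighbour : ∀ {x} → X ∋ x → adj G s x ≡ true → x ≡ t
    s-neighbour {x} x∈ sx with x Fin.≟ b | x Fin.≟ t | x Fin.≟ s
    ... | _        | yes e  | _        = e
    ... | yes refl | no _   | _        = contradiction (trans (sym sx) (trans (adj-sym G s b) bs)) λ ()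
    ... | no _     | no _   | yes refl = contradiction (trans (sym sx) (adj-irrefl G s)) λ ()
    ... | no x≢b   | no x≢t | no x≢s   =
      contradiction (trans (sym sx) (proj₂ (proj₂ (others x x∈ x≢b x≢t x≢s)))) λ ()

    twoOthers : 5 ≤ ∣ X ∣ → ∃ λ x → ∃ λ y → Other x × Other y × x ≢ y
    twoOthers 5≤ = two (2≤body 5≤) (members-injective body) bodyVertex
      where
      two : ∀ {m} {f : Fin m → Fin n} → 2 ≤ m → Injective _≡_ _≡_ f → (∀ i → Other (f i)) →
        ∃ λ x → ∃ λ y → Other x × Other y × x ≢ y
      two {suc (suc m)} (s≤s (s≤s _)) inj other =
        _ , _ , other zero , other (suc zero) , λ e → contradiction (inj e) λ ()

  open ScorpionAt

  -- Take distinct x, y among the other vertices of the first scorpion. Both t and s miss x and y,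
  -- and each other vertex misses t and s. So any b′ distinct from b has two non-neighbours besides
  -- itself, whereas its own scorpion allows only s′.
  b-unique : ∀ {X b t s b′ t′ s′} → 5 ≤ ∣ X ∣ → ScorpionAt X b t s → ScorpionAt X b′ t′ s′ → b ≡ b′
  b-unique {X} {b} {t} {s} {b′} {t′} {s′} 5≤ A A′ with b Fin.≟ b′
  ... | yes e   = e
  ... | no b≢b′ with twoOthers A 5≤
  ...   | x , y , (x∈ , x≢b , x≢t , x≢s) , (y∈ , y≢b , y≢t , y≢s) , x≢y = ⊥-elim absurd
    where
    x-cand = others A x x∈ x≢b x≢t x≢s
    y-cand = others A y y∈ y≢b y≢t y≢s
    nonadjacent : ∀ {z} → X ∋ z → z ≢ b′ → adj G b′ z ≡ false → z ≡ s′
    nonadjacent z∈ z≢b′ e with b-nonadjacent A′ z∈ e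
    ... | inj₁ z≡b′ = contradiction z≡b′ z≢b′
    ... | inj₂ z≡s′ = z≡s′
    twoNonadjacent : ∀ {z w} → X ∋ z → X ∋ w → z ≢ w → z ≢ b′ → w ≢ b′ →
      adj G b′ z ≡ false → adj G b′ w ≡ false → ⊥
    twoNonadjacent z∈ w∈ z≢w z≢b′ w≢b′ ez ew =
      z≢w (trans (nonadjacent z∈ z≢b′ ez) (sym (nonadjacent w∈ w≢b′ ew)))
    absurd : ⊥
    absurd with b′ Fin.≟ t | b′ Fin.≟ s
    ... | yes refl | _        =
      twoNonadjacent x∈ y∈ x≢y x≢t y≢t (proj₁ (proj₂ x-cand)) (proj₁ (proj₂ y-cand))
    ... | no _     | yes refl =
      twoNonadjacent x∈ y∈ x≢y x≢s y≢s (proj₂ (proj₂ x-cand)) (proj₂ (proj₂ y-cand))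
    ... | no b′≢t  | no b′≢s  with others A b′ (b∈ A′) (b≢b′ ∘ sym) b′≢t b′≢s
    ...   | _ , tb′ , sb′ = twoNonadjacent (t∈ A) (s∈ A) (t≢s A) (b′≢t ∘ sym) (b′≢s ∘ sym)
      (trans (adj-sym G b′ t) tb′) (trans (adj-sym G b′ s) sb′)

  triple-unique : ∀ {X b t s b′ t′ s′} → 5 ≤ ∣ X ∣ → ScorpionAt X b t s → ScorpionAt X b′ t′ s′ →
    b ≡ b′ × t ≡ t′ × s ≡ s′
  triple-unique 5≤ A A′ with b-unique 5≤ A A′
  ... | refl with b-nonadjacent A′ (s∈ A) (bs A)
  ...   | inj₁ s≡b  = contradiction (sym s≡b) (b≢s A)
  ...   | inj₂ refl = refl , sym (s-neighbour A (t∈ A′) (trans (adj-sym G _ _) (ts A′))) , refl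

  scorpion⇒scorpionAt : ∀ X → IsScorpion (induced G X) →
    5 ≤ ∣ X ∣ × ∃ λ b → ∃ λ t → ∃ λ s → ScorpionAt X b t s
  scorpion⇒scorpionAt X (m , H′ , 2≤m , f , f-adj) =
    ≤-trans (s≤s (s≤s (s≤s 2≤m))) (≤-reflexive (sym (↔⇒≡ f))) , w vb , w vt , w vs , record
      { path   = w-adj vb vt , w-adj vt vs , w-adj vb vs , λ e → contradiction (w-injective e) λ ()
      ; b∈     = lookup-members X _
      ; t∈     = lookup-members X _
      ; s∈     = lookup-members X _
      ; others = others′
      }
    where
    w : Fin (3 + m) → Fin n
    w p = lookup (members X) (Inverse.from f p)
    w-adj : ∀ p q → adj G (w p) (w q) ≡ adj (addBTS H′) p q
    w-adj p q = trans (f-adj _ _)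
      (cong₂ (adj (addBTS H′)) (Inverse.strictlyInverseˡ f p) (Inverse.strictlyInverseˡ f q))
    w-injective : Injective _≡_ _≡_ w
    w-injective {p} {q} e = trans (sym (Inverse.strictlyInverseˡ f p))
      (trans (cong (Inverse.to f) (members-injective X e)) (Inverse.strictlyInverseˡ f q))
    w-complete : ∀ x → X ∋ x → ∃ λ p → w p ≡ x
    w-complete x x∈ with members-complete X x x∈
    ... | i , refl = Inverse.to f i , cong (lookup (members X)) (Inverse.strictlyInverseʳ f i)
    others′ : ∀ x → X ∋ x → x ≢ w vb → x ≢ w vt → x ≢ w vs → Candidate (w vb) (w vt) (w vs) x
    others′ x x∈ x≢b x≢t x≢s with w-complete x x∈
    ... | vb   , refl = contradiction refl x≢b
    ... | vt   , refl = contradiction refl x≢t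
    ... | vs   , refl = contradiction refl x≢s
    ... | vH i , refl = w-adj vb (vH i) , w-adj vt (vH i) , w-adj vs (vH i)

  -- Enumeration of the scorpion sets by triples

  kind : Fin n → Fin n → Fin n → Fin n → Kind
  kind b t s x with x Fin.≟ b | x Fin.≟ t | x Fin.≟ s | candidate? b t s x
  ... | yes _ | _     | _     | _     = must
  ... | no _  | yes _ | _     | _     = must
  ... | no _  | no _  | yes _ | _     = must
  ... | no _  | no _  | no _  | yes _ = may
  ... | no _  | no _  | no _  | no _  = never

  scorpionAt⇒allowed : ∀ {X b t s} → ScorpionAt X b t s → ∀ x → Allowed (kind b t s x) (lookup X x)
  scorpionAt⇒allowed {X} {b} {t} {s} A x with x Fin.≟ b | x Fin.≟ t | x Fin.≟ s | candidate? b t s x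
  ... | yes refl | _        | _        | _     = subst (Allowed must) (sym (b∈ A)) tt
  ... | no _     | yes refl | _        | _     = subst (Allowed must) (sym (t∈ A)) tt
  ... | no _     | no _     | yes refl | _     = subst (Allowed must) (sym (s∈ A)) tt
  ... | no _     | no _     | no _     | yes _ = tt
  ... | no x≢b   | no x≢t   | no x≢s   | no ¬c with lookup X x in eq
  ...   | outside = tt
  ...   | inside  = ¬c (others A x eq x≢b x≢t x≢s)

  allowed⇒scorpionAt : ∀ {X b t s} → Path b t s → (∀ x → Allowed (kind b t s x) (lookup X x)) →
    ScorpionAt X b t s
  allowed⇒scorpionAt {X} {b} {t} {s} p ok = record
    { path = p ; b∈ = b∈′ ; t∈ = t∈′ ; s∈ = s∈′ ; others = others′ }
    where
    must-inside : ∀ {a} → Allowed must a → a ≡ inside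
    must-inside {inside} _ = refl
    b∈′ : X ∋ b
    b∈′ with b Fin.≟ b | ok b
    ... | yes _ | h = must-inside h
    ... | no ¬e | _ = contradiction refl ¬e
    t∈′ : X ∋ t
    t∈′ with t Fin.≟ b | t Fin.≟ t | ok t
    ... | yes _ | _     | h = must-inside h
    ... | no _  | yes _ | h = must-inside h
    ... | no _  | no ¬e | _ = contradiction refl ¬e
    s∈′ : X ∋ s
    s∈′ with s Fin.≟ b | s Fin.≟ t | s Fin.≟ s | ok s
    ... | yes _ | _     | _     | h = must-inside h
    ... | no _  | yes _ | _     | h = must-inside h
    ... | no _  | no _  | yes _ | h = must-inside h
    ... | no _  | no _  | no ¬e | _ = contradiction refl ¬e
    others′ : ∀ x → X ∋ x → x ≢ b → x ≢ t → x ≢ s → Candidate b t s x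
    others′ x x∈ x≢b x≢t x≢s with x Fin.≟ b | x Fin.≟ t | x Fin.≟ s | candidate? b t s x | ok x
    ... | yes e | _     | _     | _     | _ = contradiction e x≢b
    ... | no _  | yes e | _     | _     | _ = contradiction e x≢t
    ... | no _  | no _  | yes e | _     | _ = contradiction e x≢s
    ... | no _  | no _  | no _  | yes c | _ = c
    ... | no _  | no _  | no _  | no _  | h = ⊥-elim (subst (Allowed never) x∈ h)

  tripleSets : ℕ → Fin n → Fin n → Fin n → List (Subset n)
  tripleSets k b t s with path? b t s
  ... | yes _ = fillings (kind b t s) k
  ... | no _  = []

  ∈-tripleSets⁻ : ∀ k b t s {X} → X ∈ tripleSets k b t s → ∣ X ∣ ≡ k × ScorpionAt X b t s
  ∈-tripleSets⁻ k b t s {X} h with path? b t s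
  ... | yes p with ∈-fillings⁻ (kind b t s) k X h
  ...   | size≡ , ok = size≡ , allowed⇒scorpionAt p ok

  ∈-tripleSets⁺ : ∀ k b t s {X} → ∣ X ∣ ≡ k → ScorpionAt X b t s → X ∈ tripleSets k b t s
  ∈-tripleSets⁺ k b t s {X} size≡ A with path? b t s
  ... | yes _ = ∈-fillings⁺ (kind b t s) k X (size≡ , scorpionAt⇒allowed A)
  ... | no ¬p = contradiction (path A) ¬p

  tripleSets-unique : ∀ k b t s → Unique (tripleSets k b t s)
  tripleSets-unique k b t s with path? b t s
  ... | yes _ = fillings-unique (kind b t s) k
  ... | no _  = []

  pairSets : ℕ → Fin n → Fin n → List (Subset n)
  pairSets k b t = ⋃ (tripleSets k b t)

  vertexSets : ℕ → Fin n → List (Subset n)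
  vertexSets k b = ⋃ (pairSets k b)

  scorpionSets : ℕ → List (Subset n)
  scorpionSets k = ⋃ (vertexSets k)

  ∈-pairSets⁻ : ∀ k b t {X} → X ∈ pairSets k b t → ∣ X ∣ ≡ k × ∃ λ s → ScorpionAt X b t s
  ∈-pairSets⁻ k b t h =
    let s , h′ = ∈-⋃⁻ (tripleSets k b t) h
        size≡ , A = ∈-tripleSets⁻ k b t s h′
    in size≡ , s , A

  ∈-vertexSets⁻ : ∀ k b {X} → X ∈ vertexSets k b →
    ∣ X ∣ ≡ k × ∃ λ t → ∃ λ s → ScorpionAt X b t s
  ∈-vertexSets⁻ k b h =
    let t , h′ = ∈-⋃⁻ (pairSets k b) h
        size≡ , s , A = ∈-pairSets⁻ k b t h′
    in size≡ , t , s , A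

  ∈-scorpionSets : ∀ k → 5 ≤ k → ∀ X →
    X ∈ scorpionSets k ⇔ (∣ X ∣ ≡ k × IsScorpion (induced G X))
  ∈-scorpionSets k 5≤k X = mk⇔ to from
    where
    to : X ∈ scorpionSets k → ∣ X ∣ ≡ k × IsScorpion (induced G X)
    to h =
      let b , h′ = ∈-⋃⁻ (vertexSets k) h
          size≡ , _ , _ , A = ∈-vertexSets⁻ k b h′
      in size≡ , isScorpion A (≤-trans 5≤k (≤-reflexive (sym size≡)))
    from : ∣ X ∣ ≡ k × IsScorpion (induced G X) → X ∈ scorpionSets k
    from (size≡ , sc) =
      let _ , b , t , s , A = scorpion⇒scorpionAt X sc
      in ∈-⋃⁺ (vertexSets k) b
           (∈-⋃⁺ (pairSets k b) t (∈-⋃⁺ (tripleSets k b t) s (∈-tripleSets⁺ k b t s size≡ A)))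

  -- Each of the three nested unions is disjoint because X determines b, then t, then s.
  scorpionSets-unique : ∀ k → 5 ≤ k → Unique (scorpionSets k)
  scorpionSets-unique k 5≤k = ⋃-unique (vertexSets k)
    (λ b → ⋃-unique (pairSets k b)
      (λ t → ⋃-unique (tripleSets k b t) (tripleSets-unique k b t) same-s) same-t) same-b
    where
    5≤ : ∀ {X : Subset n} → ∣ X ∣ ≡ k → 5 ≤ ∣ X ∣
    5≤ size≡ = ≤-trans 5≤k (≤-reflexive (sym size≡))
    same-b : ∀ b b′ X → X ∈ vertexSets k b → X ∈ vertexSets k b′ → b ≡ b′
    same-b b b′ X h h′ =
      let size≡ , _ , _ , A = ∈-vertexSets⁻ k b h
          _ , _ , _ , A′ = ∈-vertexSets⁻ k b′ h′
      in b-unique (5≤ {X} size≡) A A′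
    same-t : ∀ {b} t t′ X → X ∈ pairSets k b t → X ∈ pairSets k b t′ → t ≡ t′
    same-t {b} t t′ X h h′ =
      let size≡ , _ , A = ∈-pairSets⁻ k b t h
          _ , _ , A′ = ∈-pairSets⁻ k b t′ h′
      in proj₁ (proj₂ (triple-unique (5≤ {X} size≡) A A′))
    same-s : ∀ {b t} s s′ X → X ∈ tripleSets k b t s → X ∈ tripleSets k b t s′ → s ≡ s′
    same-s {b} {t} s s′ X h h′ =
      let size≡ , A = ∈-tripleSets⁻ k b t s h
          _ , A′ = ∈-tripleSets⁻ k b t s′ h′
      in proj₂ (proj₂ (triple-unique (5≤ {X} size≡) A A′))

  -- Counting with 0-1 adjacencies

  bit : Fin n → Fin n → ℕ
  bit x y = if adj G x y then 1 else 0

  candidateBit : Fin n → Fin n → Fin n → Fin n → ℕ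
  candidateBit b t s x = (bit b x ∸ bit t x) ∸ bit s x

  pathBit : Fin n → Fin n → Fin n → ℕ
  pathBit b t s = ((bit b t + bit t s) ∸ 1) ∸ bit b s

  bit≤1 : ∀ x y → bit x y ≤ 1
  bit≤1 x y with adj G x y
  ... | true  = ≤-refl
  ... | false = z≤n

  pathBit≤1 : ∀ b t s → pathBit b t s ≤ 1
  pathBit≤1 b t s = ≤-trans (m∸n≤m _ (bit b s)) (∸-monoˡ-≤ 1 (+-mono-≤ (bit≤1 b t) (bit≤1 t s)))

  sum-mustBit-kind : ∀ {b t s} → Path b t s → sumFin (mustBit ∘ kind b t s) ≡ 3
  sum-mustBit-kind {b} {t} {s} (bt , ts , _ , b≢s) =
    trans (sumFin-cong pointwise)
      (trans (sumFin-+ (δ b) _) (cong₂ _+_ (sum-δ b)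
        (trans (sumFin-+ (δ t) (δ s)) (cong₂ _+_ (sum-δ t) (sum-δ s)))))
    where
    -- The three indicators never overlap: edges join distinct vertices, and b ≢ s is part of
    -- `Path`.
    pointwise : ∀ x → mustBit (kind b t s x) ≡ δ b x + (δ t x + δ s x)
    pointwise x with x Fin.≟ b | x Fin.≟ t | x Fin.≟ s | candidate? b t s x
    ... | yes refl | yes refl | _        | _     = contradiction refl (adj⇒≢ bt)
    ... | yes refl | no _     | yes refl | _     = contradiction refl b≢s
    ... | yes _    | no _     | no _     | _     = refl
    ... | no _     | yes refl | yes refl | _     = contradiction refl (adj⇒≢ ts)
    ... | no _     | yes _    | no _     | _     = refl
    ... | no _     | no _     | yes _    | _     = refl
    ... | no _     | no _     | no _     | yes _ = refl
    ... | no _     | no _     | no _     | no _  = refl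

  -- No comparison of x with b, t or s is needed: the formula gives 0 at b because there are no
  -- loops, at t because ts is an edge, and at s because bs is not.
  mayBit-kind : ∀ {b t s} → Path b t s → ∀ x → mayBit (kind b t s x) ≡ candidateBit b t s x
  mayBit-kind {b} {t} {s} (bt , ts , bs , _) x with x Fin.≟ b | x Fin.≟ t | x Fin.≟ s | candidate? b t s x
  ... | yes refl | _ | _ | _ rewrite adj-irrefl G x =
    sym (trans (cong (_∸ bit s x) (0∸n≡0 (bit t x))) (0∸n≡0 (bit s x)))
  ... | no _ | yes refl | _ | _ rewrite adj-sym G s x | ts =
    sym (m≤n⇒m∸n≡0 (≤-trans (m∸n≤m (bit b x) (bit x x)) (bit≤1 b x)))
  ... | no _ | no _ | yes refl | _ rewrite bs =
    sym (trans (cong (_∸ bit x x) (0∸n≡0 (bit t x))) (0∸n≡0 (bit x x)))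
  ... | no _ | no _ | no _ | yes (e , e′ , e″) rewrite e | e′ | e″ = refl
  ... | no _ | no _ | no _ | no ¬c with adj G b x | adj G t x | adj G s x
  ...   | false | b₁    | b₂    =
    sym (trans (cong (_∸ (if b₂ then 1 else 0)) (0∸n≡0 (if b₁ then 1 else 0))) (0∸n≡0 (if b₂ then 1 else 0)))
  ...   | true  | true  | b₂    = sym (0∸n≡0 (if b₂ then 1 else 0))
  ...   | true  | false | true  = refl
  ...   | true  | false | false = contradiction (refl , refl , refl) ¬c

  -- The bound on m serves the degenerate case b = s, where the path bit is 1 although the list is
  -- empty: with no candidates the binomial is 0 C m, which vanishes only for positive m.
  length-tripleSets : ∀ b t s {m} → 1 ≤ m →
    length (tripleSets (3 + m) b t s) ≡ (pathBit b t s guards sumFin (candidateBit b t s) C m)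
  length-tripleSets b t s {m} 1≤m with path? b t s
  ... | yes p@(bt , ts , bs , _) rewrite bt | ts | bs =
    trans (cong (λ k → length (fillings (kind b t s) (k + m))) (sym (sum-mustBit-kind p)))
      (trans (length-fillings (kind b t s) m) (cong (_C m) (sumFin-cong (mayBit-kind p))))
  ... | no ¬p with adj G b t | adj G t s | adj G b s
  ...   | false | false | b₃    =
    cong (λ a → a guards sumFin (candidateBit b t s) C m) (sym (0∸n≡0 (if b₃ then 1 else 0)))
  ...   | false | true  | b₃    =
    cong (λ a → a guards sumFin (candidateBit b t s) C m) (sym (0∸n≡0 (if b₃ then 1 else 0)))
  ...   | true  | false | b₃    =
    cong (λ a → a guards sumFin (candidateBit b t s) C m) (sym (0∸n≡0 (if b₃ then 1 else 0)))
  ...   | true  | true  | true  = refl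
  ...   | true  | true  | false with b Fin.≟ s
  ...     | no b≢s   = contradiction (refl , refl , refl , b≢s) ¬p
  ...     | yes refl =
    sym (trans (cong (_C m) (trans (sumFin-cong no-candidate) (sumFin-0 n))) (k>n⇒nCk≡0 {0} {m} 1≤m))
    where
    no-candidate : ∀ x → candidateBit b t b x ≡ 0
    no-candidate x = m≤n⇒m∸n≡0 (m∸n≤m (bit b x) (bit t x))

  -- Vertex b is not adjacent to itself. Strictness matters twice: the count is a valid index into
  -- the table of length n, and capping the column at n changes nothing.
  candidates<n : ∀ b t s → sumFin (candidateBit b t s) < n
  candidates<n b t s = sumFin-< b
    (λ x → ≤-trans (m∸n≤m _ (bit s x)) (≤-trans (m∸n≤m _ (bit t x)) (bit≤1 b x)))
    (m≤n⇒m∸n≡0 {n = bit s b} (≤-trans (m∸n≤m _ (bit t b))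
      (≤-trans (≤-reflexive (cong (λ a → if a then 1 else 0) (adj-irrefl G b))) z≤n)))

  length-scorpionSets : ∀ {m} → 1 ≤ m → length (scorpionSets (3 + m)) ≡
    sumFin λ b → sumFin λ t → sumFin λ s → pathBit b t s guards sumFin (candidateBit b t s) C m
  length-scorpionSets {m} 1≤m =
    trans (length-⋃ (vertexSets (3 + m))) (sumFin-cong λ b →
    trans (length-⋃ (pairSets (3 + m) b)) (sumFin-cong λ t →
    trans (length-⋃ (tripleSets (3 + m) b t)) (sumFin-cong λ s → length-tripleSets b t s 1≤m)))

-- The computed sums equal the number of scorpion sets

∑-shift : ∀ n (f : ℕ → ℕ) → ∑ (suc n) f ≡ f 0 + ∑ n (f ∘ suc)
∑-shift zero    f = sym (+-identityʳ (f 0))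
∑-shift (suc n) f = trans (cong (_+ f (suc n)) (∑-shift n f)) (+-assoc (f 0) _ (f (suc n)))

-- Links the two views of a sum: `∑` grows at its last term, as a loop does, while `sumFin` splits
-- off its first, as recursion on `Fin` does.
∑≡sumFin : ∀ n (f : ℕ → ℕ) (g : Fin n → ℕ) → (∀ x → f (toℕ x) ≡ g x) → ∑ n f ≡ sumFin g
∑≡sumFin zero    f g e = refl
∑≡sumFin (suc n) f g e =
  trans (∑-shift n f) (cong₂ _+_ (e zero) (∑≡sumFin n (f ∘ suc) (g ∘ suc) (e ∘ suc)))

toℕ-combine′ : ∀ {n} (i j : Fin n) → toℕ (combine i j) ≡ toℕ i * n + toℕ j
toℕ-combine′ {n} i j = trans (Fin.toℕ-combine i j) (cong (_+ toℕ j) (*-comm n (toℕ i)))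

entry<n² : ∀ {n} (i j : Fin n) → toℕ i * n + toℕ j < n * n
entry<n² i j = subst (_< _) (toℕ-combine′ i j) (Fin.toℕ<n (combine i j))

matrixMem-entry : ∀ {n} (G : Graph n) i j → matrixMem G (toℕ i * n + toℕ j) ≡ bit G i j
matrixMem-entry {n} G i j with toℕ i * n + toℕ j <? n * n
... | no ≮  = contradiction (entry<n² i j) ≮
... | yes p = cong (λ (x , y) → bit G x y)
  (trans (cong (remQuot n) (Fin.toℕ-injective (trans (Fin.toℕ-fromℕ< p) (sym (toℕ-combine′ i j)))))
         (Fin.remQuot-combine i j))

-- Only n ⊓ m of the m prefix-sum rounds fit into a loop of length n.
C-cap : ∀ {c n} m → c < n → c C (n ⊓ m) ≡ c C m
C-cap {c} {n} m c<n with m ≤? n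
... | yes m≤n = cong (c C_) (m≥n⇒m⊓n≡n m≤n)
... | no  m≰n = trans (cong (c C_) (m≤n⇒m⊓n≡m (<⇒≤ n<m)))
                  (trans (k>n⇒nCk≡0 c<n) (sym (k>n⇒nCk≡0 (<-trans c<n n<m))))
  where n<m = ≰⇒> m≰n

module _ {n} (G : Graph n) (M : ℕ → ℕ) (entries : ∀ i j → M (toℕ i * n + toℕ j) ≡ bit G i j) where

  isPath≡ : ∀ b t s → isPath n M (toℕ b) (toℕ t) (toℕ s) ≡ pathBit G b t s
  isPath≡ b t s = cong₂ _∸_ (cong (_∸ 1) (cong₂ _+_ (entries b t) (entries t s))) (entries b s)

  candidates≡ : ∀ b t s →
    candidates n M (toℕ b) (toℕ t) (toℕ s) ≡ sumFin (candidateBit G b t s)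
  candidates≡ b t s = ∑≡sumFin n _ _ λ x →
    cong₂ _∸_ (cong₂ _∸_ (entries b x) (entries t x)) (entries s x)

  triples≡0 : triples n 1 M ≡ 0
  triples≡0 = trans (∑≡sumFin n _ _ λ b → trans (∑≡sumFin n _ _ λ t → trans (∑≡sumFin n _ _ λ s →
      cong (_guards M (n * n + candidates n M (toℕ b) (toℕ t) (toℕ s)))
        (m≤n⇒m∸n≡0 (≤-trans (≤-reflexive (isPath≡ b t s)) (pathBit≤1 G b t s))))
    (sumFin-0 n)) (sumFin-0 n)) (sumFin-0 n)

  triples≡ : ∀ {m} → (∀ c → c < n → M (n * n + c) ≡ c C (n ⊓ m)) → triples n 0 M ≡
    sumFin λ b → sumFin λ t → sumFin λ s → pathBit G b t s guards sumFin (candidateBit G b t s) C m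
  triples≡ {m} table = ∑≡sumFin n _ _ λ b → ∑≡sumFin n _ _ λ t → ∑≡sumFin n _ _ λ s →
    cong₂ _guards_ (isPath≡ b t s)
      (trans (cong (λ c → M (n * n + c)) (candidates≡ b t s))
        (trans (table _ (candidates<n G b t s)) (C-cap m (candidates<n G b t s))))

  inducedCount : ∀ k → (∀ c → c < n → M (n * n + c) ≡ c C (n ⊓ (k ∸ 3))) →
    InducedCount scorpion G k (triples n (1 ∸ (k ∸ 4)) M)
  inducedCount k table with 5 ≤? k
  ... | yes 5≤k with m≤n⇒∃[o]m+o≡n 5≤k
  -- Writing k as 5 + o turns the column k ∸ 3 into 2 + o and the flag into `0 ∸ o`.
  ...   | o , refl = scorpionSets G k , scorpionSets-unique G k 5≤k , ∈-scorpionSets G k 5≤k ,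
    trans (length-scorpionSets G {2 + o} (s≤s z≤n))
      (sym (trans (cong (λ z → triples n z M) (0∸n≡0 o)) (triples≡ table)))
  inducedCount k table | no 5≰k =
    -- Every scorpion has at least five vertices, so the empty list is complete here.
    [] , [] , (λ X → mk⇔ (λ ()) λ (∣X∣≡k , sc) →
      contradiction (subst (5 ≤_) ∣X∣≡k (proj₁ (scorpion⇒scorpionAt G X sc))) 5≰k) ,
    sym (trans (cong (λ z → triples n (1 ∸ z) M) (m≤n⇒m∸n≡0 (≤-pred (≰⇒> 5≰k)))) triples≡0)

-- The exponent is the loop depth of the program: three loops over the triple and, inside them, the
-- one over candidates. The factor 16 is 2 to the fourth, from n + 1 ≤ 2n for n ≥ 1.
bound-quartic : bound countScorpions ∈O (λ n → n ^ 4)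
bound-quartic = f * 16 , 1 , λ n 1≤n → begin
  f * suc n ^ 4
    ≤⟨ *-monoʳ-≤ f (^-monoˡ-≤ 4 (+-monoˡ-≤ n 1≤n)) ⟩
  f * (n + n) ^ 4
    ≡⟨ cong (f *_) (double n) ⟩
  f * (16 * n ^ 4)
    ≡⟨ *-assoc f 16 (n ^ 4) ⟨
  f * 16 * n ^ 4 ∎
  where
  open ≤-Reasoning
  f = factor countScorpions
  double : ∀ n → (n + n) * ((n + n) * ((n + n) * ((n + n) * 1))) ≡ 16 * (n * (n * (n * (n * 1))))
  double = solve-∀

scorpion-countable : CountingSolvableInTimeO scorpion (λ n → n ^ 4)
scorpion-countable = P , bound countScorpions , bound-quartic , λ n G k →
  let σ = ⟨ reg (inputConfig G k) , matrixMem G ⟩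
      open Prepared (prepare-correct σ)
      halt = simulate P countScorpions 0 σ countScorpions-wellFormed (codeAt-suffix P [])
  -- The sum refers to the memory after `prepare`, which holds the intact matrix followed by the
  -- table.
  in triples n (1 ∸ (k ∸ 4)) (cells (eval prepare σ)) ,
     inducedCount G (cells (eval prepare σ))
       (λ i j → trans (below _ (entry<n² i j)) (matrixMem-entry G i j)) k table ,
     cost countScorpions σ , cost-bounded countScorpions σ countScorpions-wellFormed ,
     subst (Halted P) (sym halt)
       (≤-reflexive (trans (sym (+-identityʳ (length P))) (length-compile 0 countScorpions))) ,
     trans (cong (λ c → reg c 0) halt) (countScorpions-output σ)
  where
  P : Program
  P = compile 0 countScorpions

-- Scorpions are not meager

edgeless : ∀ n → Graph n
edgeless n = record { adj = λ _ _ → false ; adj-sym = λ _ _ → refl ; adj-irrefl = λ _ → refl }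

edgeless-not-scorpion : ∀ {n} → ¬ IsScorpion (edgeless n)
edgeless-not-scorpion (m , H′ , _ , f , f-adj) =
  contradiction (trans (f-adj (Inverse.from f vb) (Inverse.from f vt))
    (cong₂ (adj (addBTS H′)) (Inverse.strictlyInverseˡ f vb) (Inverse.strictlyInverseˡ f vt))) λ ()

-- The edgeless graph is no scorpion, as it lacks the edge bt, whereas the scorpion built on an
-- edgeless H′ of m vertices has the same number of vertices.
nontrivial : ∀ m → 2 ≤ m → ¬ Trivial scorpion (3 + m)
nontrivial m 2≤m (inj₁ all)  = edgeless-not-scorpion (all (edgeless (3 + m)))
nontrivial m 2≤m (inj₂ none) =
  none (addBTS (edgeless m)) (m , edgeless m , 2≤m , ↔-refl , λ _ _ → refl)

∈⇒≤sum : ∀ {x} xs → x ∈ xs → x ≤ sum xs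
∈⇒≤sum (x ∷ xs) (here refl) = m≤m+n x (sum xs)
∈⇒≤sum (x ∷ xs) (there h)   = ≤-trans (∈⇒≤sum xs h) (m≤n+m (sum xs) x)

scorpion-not-meager : ¬ Meager scorpion
scorpion-not-meager (exceptions , trivial) =
  nontrivial (2 + sum exceptions) (s≤s (s≤s z≤n))
    -- Every entry of a list of naturals is at most their sum, so this number is a non-exception;
    -- the summand 5 makes room for a scorpion.
    (trivial (5 + sum exceptions) λ h →
      <⇒≱ (m≤n+m (suc (sum exceptions)) 4)
        (≤-trans (≤-reflexive (+-suc 4 (sum exceptions))) (∈⇒≤sum exceptions h)))

mainTheorem2 : (¬ Meager scorpion) × CountingSolvableInTimeO scorpion (λ n → n ^ 4)
mainTheorem2 = scorpion-not-meager , scorpion-countable
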